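{- Let $\ell>0$ and $b\neq 0$ be integers satisfying $\ell^2+4b\geq 0$, and let $\mathbf{s}=(s_1,s_2,\ldots)$ be defined by $s_0=0$, $s_1=1$ and $s_n=\ell s_{n-1}+b s_{n-2}$ for $n\geq 2$. Then the lecture hall generating function $f_n^{(\mathbf{s})}(q)$ is self-reciprocal for all $n\geq 0$ if and only if $b=-1$. Moreover, if $b\neq -1$, there is an integer $n_0=n_0(b,\ell)$ such that for all $n\geq n_0$, $f_n^{(\mathbf{s})}(q)$ is not self-reciprocal, and consequently $f_n^{(\mathbf{s})}(q)$ is not of the form $\big((1-q^{e_1})(1-q^{e_2})\cdots(1-q^{e_n})\big)^{ -1}$ for any positive integers $e_1,\ldots,e_n$.
   Context: For a sequence $\mathbf{s}=(s_i)_{i\geq 1}$ of positive integers, the set of $\mathbf{s}$-lecture hall partitions of length $n$ is $\mathcal{L}_n^{(\mathbf{s})}=\{\lambda\in\mathbb{Z}^n : 0\leq \lambda_1/s_1\leq \lambda_2/s_2\leq\cdots\leq \lambda_n/s_n\}$, and $f_n^{(\mathbf{s})}(q)=\sum_{\lambda\in\mathcal{L}_n^{(\mathbf{s})}} q^{\lambda_1+\cdots+\lambda_n}$ (a rational function of $q$). A rational function $r(q)$ is self-reciprocal if there is a nonnegative integer $k$ with $r(1/q)=\pm q^k r(q)$. -}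

module Defs where

open import Data.Bool using (Bool; true; false; _∧_)
open import Data.Nat as ℕ using (ℕ; zero; suc; _∸_)
open import Data.Integer as ℤ using (ℤ; +_; _≤ᵇ_)
open import Data.List using (List; []; _∷_; _++_; map; concatMap; upTo; length; filterᵇ; replicate; reverse)
open import Data.Nat.ListAction using (sum)
open import Data.List.Relation.Unary.All using (All)
open import Data.Product using (Σ; ∃; ∃-syntax; _×_; _,_)
open import Data.Sum using (_⊎_)
open import Relation.Binary.PropositionalEquality using (_≡_; _≢_)

seq : ℤ → ℤ → ℕ → ℤ
seq ℓ b zero = ℤ.0ℤ
seq ℓ b (suc zero) = ℤ.1ℤ
seq ℓ b (suc (suc n)) = ℓ ℤ.* seq ℓ b (suc n) ℤ.+ b ℤ.* seq ℓ b n

tuples : ℕ → ℕ → List (List ℕ)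
tuples zero    m = [] ∷ []
tuples (suc n) m = concatMap (λ x → map (x ∷_) (tuples n m)) (upTo (suc m))

-- lhChain s i (λ_i ∷ λ_{i+1} ∷ …) checks λ_j / s_j ≤ λ_{j+1} / s_{j+1}
-- for consecutive entries, written (since s_j > 0) as
-- λ_j * s_{j+1} ≤ λ_{j+1} * s_j.
lhChain : (ℕ → ℤ) → ℕ → List ℕ → Bool
lhChain s i (x ∷ y ∷ rest) =
  ((+ x) ℤ.* s (suc i) ≤ᵇ (+ y) ℤ.* s i) ∧ lhChain s (suc i) (y ∷ rest)
lhChain s i _ = true

-- λ = (λ_1,…,λ_n) ∈ ℕ^n (entries of an element of L_n are automatically ≥ 0)
isLectureHall : (ℕ → ℤ) → List ℕ → Bool
isLectureHall s λs = lhChain s 1 λs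

-- coefficient of q^m in f_n^{(s)}(q): the number of λ ∈ L_n^{(s)} with |λ| = m
-- (every such λ has all entries ≤ m)
lhCoeff : (ℕ → ℤ) → ℕ → ℕ → ℤ
lhCoeff s n m =
  + length (filterᵇ (λ λs → isLectureHall s λs ∧ (sum λs ℕ.≡ᵇ m)) (tuples n m))

lhGF : (ℕ → ℤ) → ℕ → (ℕ → ℤ)
lhGF s n = lhCoeff s n

Poly : Set
Poly = List ℤ

Series : Set
Series = ℕ → ℤ

coeff : Poly → Series
coeff []       m       = ℤ.0ℤ
coeff (a ∷ P) zero    = a
coeff (a ∷ P) (suc m) = coeff P m

mulPS : Poly → Series → Series
mulPS []      f m       = ℤ.0ℤ
mulPS (a ∷ P) f zero    = a ℤ.* f zero
mulPS (a ∷ P) f (suc m) = a ℤ.* f (suc m) ℤ.+ mulPS P f m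

_≈S_ : Series → Series → Set
f ≈S g = ∀ m → f m ≡ g m

negS : Series → Series
negS f m = ℤ.- f m

shiftP : ℕ → Poly → Poly
shiftP j P = replicate j ℤ.0ℤ ++ P

NonZeroPoly : Poly → Set
NonZeroPoly Q = ∃[ m ] coeff Q m ≢ ℤ.0ℤ

-- The power series f is (the expansion of) a rational function P/Q with
-- r(1/q) = ± q^k r(q) for some k ∈ ℕ.  With p = length P, d = length Q,
-- reverse P = q^(p-1) P(1/q), reverse Q = q^(d-1) Q(1/q), so the identity
--   P(1/q) Q(q) = ± q^k P(q) Q(1/q)
-- is multiplied through by q^((p-1)+(d-1)) to become a polynomial identity.
SelfReciprocalWitness : Poly → Poly → Set
SelfReciprocalWitness P Q =
  ∃[ k ]
    let L = mulPS (shiftP (length Q ∸ 1) (reverse P)) (coeff Q)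
        R = mulPS (shiftP (k ℕ.+ (length P ∸ 1)) P) (coeff (reverse Q))
    in (L ≈S R) ⊎ (L ≈S negS R)

SelfReciprocal : Series → Set
SelfReciprocal f =
  Σ Poly λ P → Σ Poly λ Q →
    NonZeroPoly Q × (mulPS Q f ≈S coeff P) × SelfReciprocalWitness P Q

oneMinusX^ : ℕ → Poly
oneMinusX^ zero    = ℤ.0ℤ ∷ []
oneMinusX^ (suc e) = ℤ.1ℤ ∷ replicate e ℤ.0ℤ ++ (ℤ.-1ℤ ∷ [])

polyMul : Poly → Poly → Poly
polyMul P Q = map (mulPS P (coeff Q)) (upTo (length P ℕ.+ length Q))

prodOneMinus : List ℕ → Poly
prodOneMinus []       = ℤ.1ℤ ∷ []
prodOneMinus (e ∷ es) = polyMul (oneMinusX^ e) (prodOneMinus es)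

IsProductForm : ℕ → Series → Set
IsProductForm n f =
  Σ (List ℕ) λ es → (length es ≡ n) × All (0 ℕ.<_) es
    × (mulPS (prodOneMinus es) f ≈S coeff (ℤ.1ℤ ∷ []))

{-# OPTIONS --safe #-}
module Submission where

-- Let fₙ° count the interior lattice points of the lecture hall cone, whose
-- facet functionals are λᵢ₊₁ sᵢ − λᵢ sᵢ₊₁.  Cutting the cone into translates of
-- the half-open parallelepiped spanned by the rays vᵣ = (0,…,0,sᵣ,…,sₙ) writes
-- fₙ = h / D with D = ∏ (1 − q^|vᵣ|), and the reflection λ ↦ Σ vᵣ − λ of the
-- parallelepiped gives fₙ° = q^|Σ vᵣ| h(1/q) / D.  Hence fₙ is self-reciprocal iff
-- fₙ° = q^k fₙ, iff the cone has an interior lattice point c such that every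
-- interior lattice point minus c lies in the cone.
--
-- If b = -1, then cᵢ = sᵢ + sᵢ₋₁ takes the value 1 on every facet and works.
-- Conversely the facet values gⱼ = cⱼ₊₁ sⱼ − cⱼ sⱼ₊₁ of such a c divide all facet
-- values, so gⱼ divides sⱼ and sⱼ₊₁, whence gⱼ² ≤ |b|ʲ by the Cassini-type identity
-- sⱼ₊₁² − sⱼ sⱼ₊₂ = (-b)ʲ.  Moreover sⱼ₊₁ divides gⱼ₊₁ + b gⱼ, which is smaller than
-- sⱼ₊₁ for suitable j and thus vanishes.  For b > 0 this contradicts gⱼ > 0;
-- for b ≤ -2 it holds for all large j, so gⱼ grows like |b|ʲ, contradicting
-- gⱼ² ≤ |b|ʲ.

open import Defs
open import Data.Bool using (Bool; T; _∧_)
open import Data.Bool.Properties using (T-∧)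
open import Data.Nat as ℕ using (ℕ; zero; suc; _≥_; _∸_)
import Data.Nat.Properties as ℕP
open import Data.Nat.ListAction using (sum)
open import Data.Integer using (ℤ; +_; -[1+_]; -_; _-_; ∣_∣; -1ℤ; 0ℤ; 1ℤ; _+_; _*_; _<_; _≤_)
import Data.Integer as ℤ
import Data.Integer.Properties as ℤP
open import Algebra.Properties.AbelianGroup ℤP.+-0-abelianGroup using (∙-cancelʳ)
open import Data.Integer.Tactic.RingSolver using (solve-∀)
import Data.Integer.DivMod as DivMod
import Data.Nat.Tactic.RingSolver as ℕSolver
open import Data.List
  using (List; []; _∷_; _++_; map; upTo; applyUpTo; length; reverse; concatMap; cartesianProductWith; filterᵇ)
import Data.List.Properties as LP
open import Data.List.Membership.Propositional using (_∈_)
open import Data.List.Membership.Propositional.Properties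
  using (∈-∃++; ∈-++⁺ˡ; ∈-++⁺ʳ; ∈-++⁻; ∈-upTo⁺; ∈-filter⁺; ∈-filter⁻; ∈-cartesianProductWith⁺; ∈-cartesianProductWith⁻)
open import Data.List.Relation.Unary.Any using (here; there)
open import Data.List.Relation.Unary.All as All using (All; []; _∷_)
open import Data.List.Relation.Unary.AllPairs using ([]; _∷_)
open import Data.List.Relation.Unary.Unique.Propositional using (Unique)
import Data.List.Relation.Unary.Unique.Propositional.Properties as Unique
open import Data.Product using (_×_; _,_; proj₁; proj₂; ∃-syntax)
open import Data.Sum using (_⊎_; inj₁; inj₂; [_,_]′)
open import Data.Empty using (⊥; ⊥-elim)
open import Function using (_∘_; id; _⇔_; mk⇔; Equivalence)
open import Relation.Nullary using (¬_; Dec; yes; no; contradiction)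
open import Relation.Nullary.Decidable using (isYes; map′; _×-dec_; _→-dec_; toWitness; fromWitness)
open import Relation.Binary.PropositionalEquality

-- Polynomials in q and 1/q as operators

-- `SelfReciprocal` only provides some symmetric representation P / Q of the series, which need not
-- be h / D. No field of rational functions is formed: identities are cross-multiplied into
-- operators, and nonzero polynomials are cancelled afterwards. Cancelling Q(q) is sound on
-- sequences that vanish far to the left, cancelling Q(1/q) on finitely supported ones. The
-- comparison is therefore made between numerators and only then transferred to fₙ and fₙ°.
--
-- The sign in fₙ° = ± q^k fₙ is plus because both sides count points. Degree k of the interior
-- matches degree 0 of the cone, which contains the origin, so an interior point c of weight k
-- exists. Translation by c injects the cone into its interior, and equality of the counts in every
-- degree makes it onto; this is the minimality of c.
--
-- The facet values other than the j-th can be raised freely, so gⱼ is the least positive value of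
-- its facet functional on all integer points, and Euclidean division makes it divide every value.

-- Polynomials in q and 1/q act on two-sided sequences: act 1ℤ P is
-- multiplication by P(q) and act -1ℤ P is multiplication by P(1/q).
act : ℤ → Poly → (ℤ → ℤ) → ℤ → ℤ
act t []      g m = 0ℤ
act t (a ∷ P) g m = a * g m + act t P g (m - t)

act-cong : ∀ t P {f g} → f ≗ g → act t P f ≗ act t P g
act-cong t []      e m = refl
act-cong t (a ∷ P) e m = cong₂ _+_ (cong (a *_) (e m)) (act-cong t P e (m - t))

sub-swap : ∀ a b c → a - b - c ≡ a - c - b
sub-swap = solve-∀

act-shift : ∀ t P g u m → act t P (λ i → g (i - u)) m ≡ act t P g (m - u)
act-shift t []      g u m = refl
act-shift t (a ∷ P) g u m = cong (_+_ (a * g (m - u)))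
  (trans (act-shift t P g u (m - t)) (cong (act t P g) (sub-swap m t u)))

act-linear : ∀ t P a f g m → act t P (λ i → a * f i + g i) m ≡ a * act t P f m + act t P g m
act-linear t []      a f g m = sym (trans (ℤP.+-identityʳ (a * 0ℤ)) (ℤP.*-zeroʳ a))
act-linear t (b ∷ P) a f g m = trans
  (cong (_+_ (b * (a * f m + g m))) (act-linear t P a f g (m - t)))
  (regroup a b (f m) (g m) (act t P f (m - t)) (act t P g (m - t)))
  where
  regroup : ∀ a b x y u v → b * (a * x + y) + (a * u + v) ≡ a * (b * x + u) + (b * y + v)
  regroup = solve-∀

act-zero : ∀ t P m → act t P (λ _ → 0ℤ) m ≡ 0ℤ
act-zero t []      m = refl
act-zero t (a ∷ P) m = cong₂ _+_ (ℤP.*-zeroʳ a) (act-zero t P (m - t))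

act-scale : ∀ t P a f m → act t P (λ i → a * f i) m ≡ a * act t P f m
act-scale t P a f m = begin
  act t P (λ i → a * f i) m           ≡⟨ act-cong t P (λ i → sym (ℤP.+-identityʳ (a * f i))) m ⟩
  act t P (λ i → a * f i + 0ℤ) m      ≡⟨ act-linear t P a f (λ _ → 0ℤ) m ⟩
  a * act t P f m + act t P (λ _ → 0ℤ) m ≡⟨ cong (_+_ (a * act t P f m)) (act-zero t P m) ⟩
  a * act t P f m + 0ℤ                ≡⟨ ℤP.+-identityʳ _ ⟩
  a * act t P f m                     ∎
  where open ≡-Reasoning

act-comm : ∀ t P u Q g → act t P (act u Q g) ≗ act u Q (act t P g)
act-comm t []      u Q g m = sym (act-zero u Q m)
act-comm t (a ∷ P) u Q g m = begin
  a * act u Q g m + act t P (act u Q g) (m - t)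
    ≡⟨ cong (_+_ (a * act u Q g m)) (act-comm t P u Q g (m - t)) ⟩
  a * act u Q g m + act u Q (act t P g) (m - t)
    ≡⟨ cong (_+_ (a * act u Q g m)) (sym (act-shift u Q (act t P g) t m)) ⟩
  a * act u Q g m + act u Q (λ i → act t P g (i - t)) m
    ≡⟨ sym (act-linear u Q a g (λ i → act t P g (i - t)) m) ⟩
  act u Q (act t (a ∷ P) g) m ∎
  where open ≡-Reasoning

-- Replacing q by 1/q reverses the sequence and the direction in which the coefficients shift it.
act-reflect : ∀ t P g m → act t P (g ∘ -_) m ≡ act (- t) P g (- m)
act-reflect t []      g m = refl
act-reflect t (a ∷ P) g m = cong (_+_ (a * g (- m)))
  (trans (act-reflect t P g (m - t)) (cong (act (- t) P g) (neg-sub m t)))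
  where
  neg-sub : ∀ m t → - (m - t) ≡ - m - - t
  neg-sub = solve-∀

act-++ : ∀ t P R g m → act t (P ++ R) g m ≡ act t P g m + act t R g (m - t * + length P)
act-++ t []      R g m = trans (cong (act t R g) (no-shift m t)) (sym (ℤP.+-identityˡ _))
  where
  no-shift : ∀ m t → m ≡ m - t * 0ℤ
  no-shift = solve-∀
act-++ t (a ∷ P) R g m = trans
  (cong (_+_ (a * g m)) (act-++ t P R g (m - t)))
  (trans (cong (λ i → a * g m + (act t P g (m - t) + act t R g i)) (shift-suc m t (+ length P)))
         (sym (ℤP.+-assoc (a * g m) _ _)))
  where
  shift-suc : ∀ m t n → m - t - t * n ≡ m - t * (1ℤ + n)
  shift-suc = solve-∀

-- `reverse P` is q^(p - 1) P(1/q) with p the length of P; the shift by p - 1 is an integer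
-- expression, free of truncated subtraction.
act-reverse : ∀ P g m → act 1ℤ (reverse P) g m ≡ act -1ℤ P g (m + 1ℤ - + length P)
act-reverse []      g m = refl
act-reverse (a ∷ P) g m = begin
  act 1ℤ (reverse (a ∷ P)) g m
    ≡⟨ cong (λ R → act 1ℤ R g m) (LP.unfold-reverse a P) ⟩
  act 1ℤ (reverse P ++ a ∷ []) g m
    ≡⟨ act-++ 1ℤ (reverse P) (a ∷ []) g m ⟩
  act 1ℤ (reverse P) g m + (a * g (m - 1ℤ * + length (reverse P)) + 0ℤ)
    ≡⟨ cong₂ (λ x n → x + (a * g (m - 1ℤ * + n) + 0ℤ)) (act-reverse P g m) (LP.length-reverse P) ⟩
  act -1ℤ P g (m + 1ℤ - + length P) + (a * g (m - 1ℤ * + length P) + 0ℤ)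
    ≡⟨ ℤP.+-comm (act -1ℤ P g (m + 1ℤ - + length P)) _ ⟩
  a * g (m - 1ℤ * + length P) + 0ℤ + act -1ℤ P g (m + 1ℤ - + length P)
    ≡⟨ cong₂ (λ x y → x + act -1ℤ P g y) (trans (ℤP.+-identityʳ _) (cong (λ i → a * g i) (index₁ m (+ length P)))) (index₂ m (+ length P)) ⟩
  a * g (m + 1ℤ - (1ℤ + + length P)) + act -1ℤ P g (m + 1ℤ - (1ℤ + + length P) - -1ℤ) ∎
  where
  open ≡-Reasoning
  index₁ : ∀ m n → m - 1ℤ * n ≡ m + 1ℤ - (1ℤ + n)
  index₁ = solve-∀
  index₂ : ∀ m n → m + 1ℤ - n ≡ m + 1ℤ - (1ℤ + n) - -1ℤ
  index₂ = solve-∀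

act-shiftP : ∀ t j P g m → act t (shiftP j P) g m ≡ act t P g (m - t * + j)
act-shiftP t zero    P g m = cong (act t P g) (no-shift m t)
  where
  no-shift : ∀ m t → m ≡ m - t * 0ℤ
  no-shift = solve-∀
act-shiftP t (suc j) P g m = trans (ℤP.+-identityˡ _)
  (trans (act-shiftP t j P g (m - t)) (cong (act t P g) (sub-suc m t (+ j))))
  where
  sub-suc : ∀ m t j → m - t - t * j ≡ m - t * (1ℤ + j)
  sub-suc = solve-∀

ext : Series → ℤ → ℤ
ext f (+ m)    = f m
ext f -[1+ _ ] = 0ℤ

ext-cong : ∀ {f g} → f ≈S g → ext f ≗ ext g
ext-cong e (+ m)    = e m
ext-cong e -[1+ _ ] = refl

act-ext : ∀ P f → act 1ℤ P (ext f) ≗ ext (mulPS P f)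
act-ext []      f (+ m)       = refl
act-ext []      f -[1+ m ]    = refl
act-ext (a ∷ P) f (+ zero)    = trans (cong (_+_ (a * f 0)) (act-ext P f -[1+ 0 ])) (ℤP.+-identityʳ _)
act-ext (a ∷ P) f (+ (suc m)) = cong (_+_ (a * f (suc m))) (act-ext P f (+ m))
act-ext (a ∷ P) f -[1+ m ]    = trans (cong (_+_ (a * 0ℤ)) (act-ext P f (-[1+ m ] - 1ℤ)))
                                      (trans (ℤP.+-identityʳ _) (ℤP.*-zeroʳ a))

-- The constant 1 as a sequence. Acting on it turns P(q) or P(1/q) into its coefficient sequence, so
-- polynomial identities become operator identities.
δ : ℤ → ℤ
δ = ext (coeff (1ℤ ∷ []))

δ-reflect : δ ∘ -_ ≗ δ
δ-reflect (+ zero)    = refl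
δ-reflect (+ suc m)   = refl
δ-reflect -[1+ m ]    = refl

mulPS-one : ∀ P → mulPS P (coeff (1ℤ ∷ [])) ≈S coeff P
mulPS-one []      m       = refl
mulPS-one (a ∷ P) zero    = ℤP.*-identityʳ a
mulPS-one (a ∷ P) (suc m) = trans (cong₂ _+_ (ℤP.*-zeroʳ a) (mulPS-one P m)) (ℤP.+-identityˡ _)

act-δ : ∀ P → act 1ℤ P δ ≗ ext (coeff P)
act-δ P m = trans (act-ext P (coeff (1ℤ ∷ [])) m) (ext-cong (mulPS-one P) m)

act-reflect-δ : ∀ t P m → act t P δ m ≡ act (- t) P δ (- m)
act-reflect-δ t P m = trans (act-cong t P (λ i → sym (δ-reflect i)) m) (act-reflect t P δ m)

-- Cancellation of nonzero polynomials

VanishesBelow : (ℤ → ℤ) → ℤ → Set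
VanishesBelow f N = ∀ i → i < N → f i ≡ 0ℤ

pred< : ∀ i → i - 1ℤ < i
pred< i = ℤP.i≤pred[j]⇒i<j (ℤP.≤-reflexive (ℤP.+-comm i -1ℤ))

act-vanishesBelow : ∀ P f N → VanishesBelow f N → VanishesBelow (act 1ℤ P f) N
act-vanishesBelow []      f N z i i<N = refl
act-vanishesBelow (a ∷ P) f N z i i<N = cong₂ _+_
  (trans (cong (a *_) (z i i<N)) (ℤP.*-zeroʳ a))
  (act-vanishesBelow P f N z (i - 1ℤ) (ℤP.<-trans (pred< i) i<N))

i<j+1⇒i≤j : ∀ {i j} → i < j + 1ℤ → i ≤ j
i<j+1⇒i≤j {i} {j} lt = subst (i ≤_) (trans (cong ℤ.pred (ℤP.+-comm j 1ℤ)) (ℤP.pred-suc j)) (ℤP.i<j⇒i≤pred[j] lt)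

-- At the lowest index where f could be nonzero only the leading term `a * f i` survives, so the
-- bound below which f vanishes rises by one with each n.
act-injective-head : ∀ a P f N → a ≢ 0ℤ → VanishesBelow f N → (∀ m → act 1ℤ (a ∷ P) f m ≡ 0ℤ) → ∀ n → VanishesBelow f (N + + n)
act-injective-head a P f N a≢0 z e zero    i lt = z i (subst (i <_) (ℤP.+-identityʳ N) lt)
act-injective-head a P f N a≢0 z e (suc n) i lt with act-injective-head a P f N a≢0 z e n | i ℤ.<? N + + n
... | ih | yes p = ih i p
... | ih | no ¬p = [ (λ a≡0 → contradiction a≡0 a≢0) , (λ x → x) ]′ (ℤP.i*j≡0⇒i≡0∨j≡0 a top)
  where
  i≤ : i ≤ N + + n
  i≤ = i<j+1⇒i≤j (subst (i <_) (assoc N (+ n)) lt)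
    where
    assoc : ∀ N n → N + (1ℤ + n) ≡ N + n + 1ℤ
    assoc = solve-∀
  top : a * f i ≡ 0ℤ
  top = begin
    a * f i                              ≡⟨ sym (ℤP.+-identityʳ _) ⟩
    a * f i + 0ℤ                         ≡⟨ cong (_+_ (a * f i)) (sym (act-vanishesBelow P f (N + + n) ih (i - 1ℤ) (ℤP.<-≤-trans (pred< i) i≤))) ⟩
    a * f i + act 1ℤ P f (i - 1ℤ)        ≡⟨ e i ⟩
    0ℤ                                   ∎
    where open ≡-Reasoning

exceeds : ∀ N i → ∃[ n ] i < N + + n
exceeds N i = suc ∣ i - N ∣ , ℤP.≤-<-trans (ℤP.≤-reflexive (split i N))
  (ℤP.+-monoʳ-< N (ℤP.≤-<-trans (i≤∣i∣ (i - N)) (ℤ.+<+ ℕP.≤-refl)))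
  where
  split : ∀ i N → i ≡ N + (i - N)
  split = solve-∀
  i≤∣i∣ : ∀ i → i ≤ + ∣ i ∣
  i≤∣i∣ (+ n)    = ℤP.≤-refl
  i≤∣i∣ -[1+ n ] = ℤ.-≤+

act-injective : ∀ Q f N → NonZeroPoly Q → VanishesBelow f N → (∀ m → act 1ℤ Q f m ≡ 0ℤ) → ∀ m → f m ≡ 0ℤ
act-injective []      f N (_ , nz) z e m = contradiction refl nz
act-injective (a ∷ Q) f N nz z e m with a ℤ.≟ 0ℤ
... | no a≢0 = act-injective-head a Q f N a≢0 z e (proj₁ (exceeds N m)) m (proj₂ (exceeds N m))
... | yes refl = act-injective Q f N (tail nz) z tail-zero m
  where
  tail : NonZeroPoly (0ℤ ∷ Q) → NonZeroPoly Q
  tail (zero  , nz) = contradiction refl nz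
  tail (suc k , nz) = k , nz
  tail-zero : ∀ m → act 1ℤ Q f m ≡ 0ℤ
  tail-zero m = trans (cong (act 1ℤ Q f) (shift m)) (trans (sym (ℤP.+-identityˡ _)) (e (m + 1ℤ)))
    where
    shift : ∀ m → m ≡ m + 1ℤ - 1ℤ
    shift = solve-∀

act-cancel : ∀ Q f g N → NonZeroPoly Q → VanishesBelow f N → VanishesBelow g N →
             act 1ℤ Q f ≗ act 1ℤ Q g → f ≗ g
act-cancel Q f g N nz zf zg e m = sym (trans
  (sym (ℤP.+-identityʳ (g m))) (trans (cong (_+_ (g m)) (sym diff0)) (cancel (f m) (g m))))
  where
  h : ℤ → ℤ
  h i = -1ℤ * g i + f i
  h0 : ∀ m → act 1ℤ Q h m ≡ 0ℤ
  h0 m = trans (act-linear 1ℤ Q -1ℤ g f m) (trans (cong (_+_ (-1ℤ * act 1ℤ Q g m)) (e m)) (inv (act 1ℤ Q g m)))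
    where
    inv : ∀ x → -1ℤ * x + x ≡ 0ℤ
    inv = solve-∀
  diff0 : h m ≡ 0ℤ
  diff0 = act-injective Q h N nz (λ i lt → cong₂ (λ x y → -1ℤ * x + y) (zg i lt) (zf i lt)) h0 m
  cancel : ∀ x y → y + (-1ℤ * y + x) ≡ x
  cancel = solve-∀

ext-below : ∀ f → VanishesBelow (ext f) 0ℤ
ext-below f -[1+ _ ] _ = refl
ext-below f (+ _) (ℤ.+<+ ())

-- Bounded on both sides, since reflection exchanges the two ends; this is what allows Q(1/q) to be
-- cancelled.
FiniteSupport : (ℤ → ℤ) → Set
FiniteSupport f = ∃[ N ] (∀ m → N ℕ.< ∣ m ∣ → f m ≡ 0ℤ)

finite⇒below : ∀ {f} ((N , _) : FiniteSupport f) N' → N ℕ.≤ N' → VanishesBelow f (- + N')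
finite⇒below (N , z) N' le i i< = z i (ℕP.≤-<-trans le (lemma N' i i<))
  where
  lemma : ∀ N i → i < - + N → N ℕ.< ∣ i ∣
  lemma zero    -[1+ n ] _           = ℕ.s≤s ℕ.z≤n
  lemma zero    (+ n) (ℤ.+<+ ())
  lemma (suc N) -[1+ n ] (ℤ.-<- lt) = ℕ.s≤s lt

δ-finite : FiniteSupport δ
δ-finite = 0 , λ { (+ suc m) _ → refl ; -[1+ m ] _ → refl }

reflect-finite : ∀ {f} → FiniteSupport f → FiniteSupport (f ∘ -_)
reflect-finite (N , z) = N , λ m lt → z (- m) (subst (N ℕ.<_) (sym (ℤP.∣-i∣≡∣i∣ m)) lt)

shift-finite : ∀ {f} u → FiniteSupport f → FiniteSupport (λ i → f (i - u))
shift-finite u (N , z) = N ℕ.+ ∣ u ∣ , λ m lt → z (m - u)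
  (ℕP.+-cancelʳ-< (∣ u ∣) N (∣ m - u ∣) (ℕP.<-≤-trans lt
    (subst (ℕ._≤ ∣ m - u ∣ ℕ.+ ∣ u ∣) (cong ∣_∣ (restore m u)) (ℤP.∣i+j∣≤∣i∣+∣j∣ (m - u) u))))
  where
  restore : ∀ m u → m - u + u ≡ m
  restore = solve-∀

linear-finite : ∀ {f g} a → FiniteSupport f → FiniteSupport g → FiniteSupport (λ i → a * f i + g i)
linear-finite a (N , z) (N' , z') = N ℕ.+ N' , λ m lt → cong₂ _+_
  (trans (cong (a *_) (z m (ℕP.≤-<-trans (ℕP.m≤m+n N N') lt))) (ℤP.*-zeroʳ a))
  (z' m (ℕP.≤-<-trans (ℕP.m≤n+m N' N) lt))

zero-finite : FiniteSupport (λ _ → 0ℤ)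
zero-finite = 0 , λ _ _ → refl

act-finite : ∀ t P {f} → FiniteSupport f → FiniteSupport (act t P f)
act-finite t []      fs = zero-finite
act-finite t (a ∷ P) fs = linear-finite a fs (shift-finite t (act-finite t P fs))

scale-finite : ∀ {f} a → FiniteSupport f → FiniteSupport (λ i → a * f i)
scale-finite a (N , z) = N , λ m lt → trans (cong (a *_) (z m lt)) (ℤP.*-zeroʳ a)

act-cancel-finite : ∀ Q {f g} → NonZeroPoly Q → FiniteSupport f → FiniteSupport g →
                    act 1ℤ Q f ≗ act 1ℤ Q g → f ≗ g
act-cancel-finite Q nz F@(N , _) G@(N' , _) = act-cancel Q _ _ (- + (N ℕ.+ N')) nz
  (finite⇒below F _ (ℕP.m≤m+n N N')) (finite⇒below G _ (ℕP.m≤n+m N' N))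

act*-cancel-finite : ∀ Q {f g} → NonZeroPoly Q → FiniteSupport f → FiniteSupport g →
                     act -1ℤ Q f ≗ act -1ℤ Q g → f ≗ g
act*-cancel-finite Q {f} {g} nz F G e m = subst (λ i → f i ≡ g i) (ℤP.neg-involutive m)
  (act-cancel-finite Q nz (reflect-finite F) (reflect-finite G)
    (λ i → trans (act-reflect 1ℤ Q f i) (trans (e (- i)) (sym (act-reflect 1ℤ Q g i)))) (- m))

-- Self-reciprocity of rational functions with denominator ∏ (1 − q^e)

act-coeff : ∀ t P R g → coeff P ≈S coeff R → act t P g ≗ act t R g
act-coeff t []      []      g e m = refl
act-coeff t []      (b ∷ R) g e m = 
  cong₂ (λ x y → x * g m + y) (e 0) (act-coeff t [] R g (e ∘ suc) (m - t))
act-coeff t (a ∷ P) []      g e m = cong₂ (λ x y → x * g m + y) (e 0) (act-coeff t P [] g (e ∘ suc) (m - t))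
act-coeff t (a ∷ P) (b ∷ R) g e m = cong₂ (λ x y → x * g m + y) (e 0) (act-coeff t P R g (e ∘ suc) (m - t))

coeff-beyond : ∀ P m → length P ℕ.≤ m → coeff P m ≡ 0ℤ
coeff-beyond []      m       le         = refl
coeff-beyond (a ∷ P) (suc m) (ℕ.s≤s le) = coeff-beyond P m le

coeff-applyUpTo : ∀ f n m → (n ℕ.≤ m → f m ≡ 0ℤ) → coeff (applyUpTo f n) m ≡ f m
coeff-applyUpTo f zero    m       z = sym (z ℕ.z≤n)
coeff-applyUpTo f (suc n) zero    z = refl
coeff-applyUpTo f (suc n) (suc m) z = coeff-applyUpTo (f ∘ suc) n m (z ∘ ℕ.s≤s)

mulPS-beyond : ∀ P Q m → length P ℕ.+ length Q ℕ.≤ m → mulPS P (coeff Q) m ≡ 0ℤ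
mulPS-beyond []      Q m       le         = refl
mulPS-beyond (a ∷ P) Q (suc m) (ℕ.s≤s le) = cong₂ _+_
  (trans (cong (a *_) (coeff-beyond Q (suc m) (ℕP.m≤n⇒m≤1+n (ℕP.m+n≤o⇒n≤o (length P) le)))) (ℤP.*-zeroʳ a))
  (mulPS-beyond P Q m le)

coeff-polyMul : ∀ P Q → coeff (polyMul P Q) ≈S mulPS P (coeff Q)
coeff-polyMul P Q m = trans
  (cong (λ R → coeff R m) (LP.map-upTo (mulPS P (coeff Q)) (length P ℕ.+ length Q)))
  (coeff-applyUpTo (mulPS P (coeff Q)) _ m (mulPS-beyond P Q m))

addP : Poly → Poly → Poly
addP []      R       = R
addP (a ∷ P) []      = a ∷ P
addP (a ∷ P) (b ∷ R) = a + b ∷ addP P R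

-- A second product with the same coefficients as `polyMul`, recursive in the first factor so that
-- its action is visibly the composite of the two actions.
mulP : Poly → Poly → Poly
mulP []      Q = []
mulP (a ∷ P) Q = addP (map (a *_) Q) (0ℤ ∷ mulP P Q)

act-addP : ∀ t P R g m → act t (addP P R) g m ≡ act t P g m + act t R g m
act-addP t []      R       g m = sym (ℤP.+-identityˡ _)
act-addP t (a ∷ P) []      g m = sym (ℤP.+-identityʳ _)
act-addP t (a ∷ P) (b ∷ R) g m = trans
  (cong (_+_ ((a + b) * g m)) (act-addP t P R g (m - t)))
  (regroup a b (g m) (act t P g (m - t)) (act t R g (m - t)))
  where
  regroup : ∀ a b x y z → (a + b) * x + (y + z) ≡ a * x + y + (b * x + z)
  regroup = solve-∀

act-map-* : ∀ t a P g m → act t (map (a *_) P) g m ≡ a * act t P g m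
act-map-* t a []      g m = sym (ℤP.*-zeroʳ a)
act-map-* t a (b ∷ P) g m = trans
  (cong (_+_ (a * b * g m)) (act-map-* t a P g (m - t)))
  (regroup a b (g m) (act t P g (m - t)))
  where
  regroup : ∀ a b x y → a * b * x + a * y ≡ a * (b * x + y)
  regroup = solve-∀

act-mulP : ∀ t P Q g → act t (mulP P Q) g ≗ act t P (act t Q g)
act-mulP t []      Q g m = refl
act-mulP t (a ∷ P) Q g m = trans
  (act-addP t (map (a *_) Q) (0ℤ ∷ mulP P Q) g m)
  (cong₂ _+_ (act-map-* t a Q g m) (trans (ℤP.+-identityˡ _) (act-mulP t P Q g (m - t))))

coeff-mulP : ∀ P Q → coeff (mulP P Q) ≈S mulPS P (coeff Q)
coeff-mulP P Q m = begin
  coeff (mulP P Q) m               ≡⟨ sym (act-δ (mulP P Q) (+ m)) ⟩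
  act 1ℤ (mulP P Q) δ (+ m)        ≡⟨ act-mulP 1ℤ P Q δ (+ m) ⟩
  act 1ℤ P (act 1ℤ Q δ) (+ m)      ≡⟨ act-cong 1ℤ P (act-δ Q) (+ m) ⟩
  act 1ℤ P (ext (coeff Q)) (+ m)   ≡⟨ act-ext P (coeff Q) (+ m) ⟩
  mulPS P (coeff Q) m              ∎
  where open ≡-Reasoning

act-polyMul : ∀ t P Q g → act t (polyMul P Q) g ≗ act t P (act t Q g)
act-polyMul t P Q g m = trans
  (act-coeff t (polyMul P Q) (mulP P Q) g (λ i → trans (coeff-polyMul P Q i) (sym (coeff-mulP P Q i))) m)
  (act-mulP t P Q g m)

act-oneMinusX^ : ∀ t e g m → act t (oneMinusX^ e) g m ≡ g m - g (m - t * + e)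
act-oneMinusX^ t zero    g m = sym (trans (cong (λ i → g m - g i) (no-shift m t)) (ℤP.+-inverseʳ (g m)))
  where
  no-shift : ∀ m t → m - t * 0ℤ ≡ m
  no-shift = solve-∀
act-oneMinusX^ t (suc e) g m = trans
  (cong (_+_ (1ℤ * g m)) (act-shiftP t e (-1ℤ ∷ []) g (m - t)))
  (trans (simplify (g m) (g (m - t - t * + e))) (cong (λ i → g m - g i) (index m t (+ e))))
  where
  simplify : ∀ x y → 1ℤ * x + (-1ℤ * y + 0ℤ) ≡ x - y
  simplify = solve-∀
  index : ∀ m t e → m - t - t * e ≡ m - t * (1ℤ + e)
  index = solve-∀

prodAct : ℤ → List ℕ → (ℤ → ℤ) → ℤ → ℤ
prodAct t []       g m = g m
prodAct t (e ∷ es) g m = prodAct t es g m - prodAct t es g (m - t * + e)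

act-prodOneMinus : ∀ t es g → act t (prodOneMinus es) g ≗ prodAct t es g
act-prodOneMinus t []       g m = trans (ℤP.+-identityʳ _) (ℤP.*-identityˡ (g m))
act-prodOneMinus t (e ∷ es) g m = trans
  (act-polyMul t (oneMinusX^ e) (prodOneMinus es) g m)
  (trans (act-oneMinusX^ t e (act t (prodOneMinus es) g) m)
         (cong₂ _-_ (act-prodOneMinus t es g m) (act-prodOneMinus t es g (m - t * + e))))

sgn : List ℕ → ℤ
sgn []       = 1ℤ
sgn (_ ∷ es) = - sgn es

IsSign : ℤ → Set
IsSign ε = ε ≡ 1ℤ ⊎ ε ≡ -1ℤ

neg-sign : ∀ {ε} → IsSign ε → IsSign (- ε)
neg-sign (inj₁ refl) = inj₂ refl
neg-sign (inj₂ refl) = inj₁ refl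

*-sign : ∀ {ε η} → IsSign ε → IsSign η → IsSign (ε * η)
*-sign (inj₁ refl) (inj₁ refl) = inj₁ refl
*-sign (inj₁ refl) (inj₂ refl) = inj₂ refl
*-sign (inj₂ refl) (inj₁ refl) = inj₂ refl
*-sign (inj₂ refl) (inj₂ refl) = inj₁ refl

sgn-sign : ∀ es → IsSign (sgn es)
sgn-sign []       = inj₁ refl
sgn-sign (e ∷ es) = neg-sign (sgn-sign es)

-- Each factor satisfies 1 - q^(-e) = - q^(-e) (1 - q^e); the product collects the sign and the
-- total exponent.
prodAct-inverse : ∀ es g m → prodAct -1ℤ es g m ≡ sgn es * prodAct 1ℤ es g (m + + sum es)
prodAct-inverse []       g m = sym (trans (ℤP.*-identityˡ _) (cong g (ℤP.+-identityʳ m)))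
prodAct-inverse (e ∷ es) g m = begin
  prodAct -1ℤ es g m - prodAct -1ℤ es g (m - -1ℤ * + e)
    ≡⟨ cong₂ _-_ (prodAct-inverse es g m) (prodAct-inverse es g (m - -1ℤ * + e)) ⟩
  ε * G (m + M) - ε * G (m - -1ℤ * + e + M)
    ≡⟨ cong₂ (λ i j → ε * G i - ε * G j) (index₁ m (+ e) M) (index₂ m (+ e) M) ⟩
  ε * G (m + (+ e + M) - 1ℤ * + e) - ε * G (m + (+ e + M))
    ≡⟨ swap ε (G (m + (+ e + M) - 1ℤ * + e)) (G (m + (+ e + M))) ⟩
  - ε * (G (m + (+ e + M)) - G (m + (+ e + M) - 1ℤ * + e)) ∎
  where
  open ≡-Reasoning
  ε = sgn es
  G = prodAct 1ℤ es g
  M = + sum es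
  index₁ : ∀ m e M → m + M ≡ m + (e + M) - 1ℤ * e
  index₁ = solve-∀
  index₂ : ∀ m e M → m - -1ℤ * e + M ≡ m + (e + M)
  index₂ = solve-∀
  swap : ∀ ε x y → ε * x - ε * y ≡ - ε * (y - x)
  swap = solve-∀

act-prodOneMinus-inverse : ∀ es g m →
  act -1ℤ (prodOneMinus es) g m ≡ sgn es * act 1ℤ (prodOneMinus es) g (m + + sum es)
act-prodOneMinus-inverse es g m = trans (act-prodOneMinus -1ℤ es g m)
  (trans (prodAct-inverse es g m) (cong (sgn es *_) (sym (act-prodOneMinus 1ℤ es g (m + + sum es)))))

-- The subtracted term of each factor sits at the negative index -e, so the induction for the
-- constant term has to carry the vanishing below 0 along.
prodOneMinus-constant : ∀ es → All (0 ℕ.<_) es →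
  prodAct 1ℤ es δ 0ℤ ≡ 1ℤ × VanishesBelow (prodAct 1ℤ es δ) 0ℤ
prodOneMinus-constant []       []          = refl , λ { -[1+ i ] _ → refl ; (+ n) (ℤ.+<+ ()) }
prodOneMinus-constant (suc e ∷ es) (pos ∷ poss) with prodOneMinus-constant es poss
... | one , below =
  cong₂ _-_ one (below (0ℤ - 1ℤ * + suc e) (drop< 0ℤ)) ,
  λ i lt → cong₂ _-_ (below i lt) (below (i - 1ℤ * + suc e) (ℤP.<-trans (drop< i) lt))
  where
  drop< : ∀ i → i - 1ℤ * + suc e < i
  drop< i = subst (i - 1ℤ * + suc e <_) (ℤP.+-identityʳ i) (ℤP.+-monoʳ-< i ℤ.-<+)

prodOneMinus-nonZero : ∀ es → All (0 ℕ.<_) es → NonZeroPoly (prodOneMinus es)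
prodOneMinus-nonZero es pos = 0 , λ z → contradiction (trans (sym value) z) λ ()
  where
  value : coeff (prodOneMinus es) 0 ≡ 1ℤ
  value = trans (sym (act-δ (prodOneMinus es) 0ℤ))
    (trans (act-prodOneMinus 1ℤ es δ 0ℤ) (proj₁ (prodOneMinus-constant es pos)))

lhs-act : ∀ P Q m →
  ext (mulPS (shiftP (length Q ∸ 1) (reverse P)) (coeff Q)) m
  ≡ act -1ℤ P (act 1ℤ Q δ) (m - 1ℤ * + (length Q ∸ 1) + 1ℤ - + length P)
lhs-act P Q m = begin
  ext (mulPS (shiftP d (reverse P)) (coeff Q)) m
    ≡⟨ sym (act-ext (shiftP d (reverse P)) (coeff Q) m) ⟩
  act 1ℤ (shiftP d (reverse P)) (ext (coeff Q)) m
    ≡⟨ act-cong 1ℤ (shiftP d (reverse P)) (λ i → sym (act-δ Q i)) m ⟩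
  act 1ℤ (shiftP d (reverse P)) (act 1ℤ Q δ) m
    ≡⟨ act-shiftP 1ℤ d (reverse P) (act 1ℤ Q δ) m ⟩
  act 1ℤ (reverse P) (act 1ℤ Q δ) (m - 1ℤ * + d)
    ≡⟨ act-reverse P (act 1ℤ Q δ) (m - 1ℤ * + d) ⟩
  act -1ℤ P (act 1ℤ Q δ) (m - 1ℤ * + d + 1ℤ - + length P) ∎
  where
  open ≡-Reasoning
  d = length Q ∸ 1

rhs-act : ∀ k P Q m →
  ext (mulPS (shiftP k P) (coeff (reverse Q))) m
  ≡ act -1ℤ Q (act 1ℤ P δ) (m - 1ℤ * + k + 1ℤ - + length Q)
rhs-act k P Q m = begin
  ext (mulPS (shiftP k P) (coeff (reverse Q))) m
    ≡⟨ sym (act-ext (shiftP k P) (coeff (reverse Q)) m) ⟩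
  act 1ℤ (shiftP k P) (ext (coeff (reverse Q))) m
    ≡⟨ act-shiftP 1ℤ k P (ext (coeff (reverse Q))) m ⟩
  act 1ℤ P (ext (coeff (reverse Q))) (m - 1ℤ * + k)
    ≡⟨ act-cong 1ℤ P (λ i → sym (act-δ (reverse Q) i)) (m - 1ℤ * + k) ⟩
  act 1ℤ P (act 1ℤ (reverse Q) δ) (m - 1ℤ * + k)
    ≡⟨ act-comm 1ℤ P 1ℤ (reverse Q) δ (m - 1ℤ * + k) ⟩
  act 1ℤ (reverse Q) (act 1ℤ P δ) (m - 1ℤ * + k)
    ≡⟨ act-reverse Q (act 1ℤ P δ) (m - 1ℤ * + k) ⟩
  act -1ℤ Q (act 1ℤ P δ) (m - 1ℤ * + k + 1ℤ - + length Q) ∎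
  where open ≡-Reasoning

-- P(1/q) Q(q) = ε q^k P(q) Q(1/q), without the power of q by which `SelfReciprocalWitness` clears
-- the negative exponents.
Reciprocal : Poly → Poly → ℕ → ℤ → Set
Reciprocal P Q k ε = ∀ m → act -1ℤ P (act 1ℤ Q δ) m ≡ ε * act -1ℤ Q (act 1ℤ P δ) (m - + k)

ext-neg : ∀ f m → ext (negS f) m ≡ -1ℤ * ext f m
ext-neg f (+ m)    = sym (ℤP.-1*i≡-i (f m))
ext-neg f -[1+ m ] = refl

-- For nonempty coefficient lists the truncated `length - 1` becomes the length of the tail.
module _ (x : ℤ) (P : Poly) (y : ℤ) (Q : Poly) (k : ℕ) where

  private
    p q : ℤ
    p = + length P
    q = + length Q

    L R : Series
    L = mulPS (shiftP (length Q) (reverse (x ∷ P))) (coeff (y ∷ Q))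
    R = mulPS (shiftP (k ℕ.+ length P) (x ∷ P)) (coeff (reverse (y ∷ Q)))

    L′ R′ : ℤ → ℤ
    L′ = act -1ℤ (x ∷ P) (act 1ℤ (y ∷ Q) δ)
    R′ = act -1ℤ (y ∷ Q) (act 1ℤ (x ∷ P) δ)

    L-act : ∀ m → ext L m ≡ L′ (m - p - q)
    L-act m = trans (lhs-act (x ∷ P) (y ∷ Q) m) (cong L′ (index m p q))
      where
      index : ∀ m p q → m - 1ℤ * q + 1ℤ - (1ℤ + p) ≡ m - p - q
      index = solve-∀

    R-act : ∀ m → ext R m ≡ R′ (m - p - q - + k)
    R-act m = trans (rhs-act (k ℕ.+ length P) (x ∷ P) (y ∷ Q) m) (cong R′ (index m p q (+ k)))
      where
      index : ∀ m p q k → m - 1ℤ * (k + p) + 1ℤ - (1ℤ + q) ≡ m - p - q - k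
      index = solve-∀

    restore : ∀ m p q → m + p + q - p - q ≡ m
    restore = solve-∀

    forward : ∀ ε → (∀ m → ext L m ≡ ε * ext R m) → Reciprocal (x ∷ P) (y ∷ Q) k ε
    forward ε e m = subst (λ i → L′ i ≡ ε * R′ (i - + k)) (restore m p q)
      (trans (sym (L-act (m + p + q))) (trans (e (m + p + q)) (cong (ε *_) (R-act (m + p + q)))))

    backward : ∀ ε → Reciprocal (x ∷ P) (y ∷ Q) k ε → ∀ m → ext L m ≡ ε * ext R m
    backward ε r m = trans (L-act m) (trans (r (m - p - q)) (cong (ε *_) (sym (R-act m))))

  witness⇒reciprocal : (L ≈S R) ⊎ (L ≈S negS R) → ∃[ ε ] IsSign ε × Reciprocal (x ∷ P) (y ∷ Q) k ε
  witness⇒reciprocal (inj₁ e) = 1ℤ , inj₁ refl , forward 1ℤ (λ m → trans (ext-cong e m) (sym (ℤP.*-identityˡ _)))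
  witness⇒reciprocal (inj₂ e) = -1ℤ , inj₂ refl , forward -1ℤ (λ m → trans (ext-cong e m) (ext-neg R m))

  reciprocal⇒witness : ∀ {ε} → IsSign ε → Reciprocal (x ∷ P) (y ∷ Q) k ε → (L ≈S R) ⊎ (L ≈S negS R)
  reciprocal⇒witness (inj₁ refl) r = inj₁ λ m → trans (backward 1ℤ r (+ m)) (ℤP.*-identityˡ _)
  reciprocal⇒witness (inj₂ refl) r = inj₂ λ m → trans (backward -1ℤ r (+ m)) (ℤP.-1*i≡-i _)

selfReciprocalWitness⇒ : ∀ P Q → SelfReciprocalWitness P Q → ∃[ k ] ∃[ ε ] IsSign ε × Reciprocal P Q k ε
-- An empty list is the zero polynomial and makes both sides vanish, so exponent 0 and sign 1 serve.
selfReciprocalWitness⇒ []      Q       _       = 0 , 1ℤ , inj₁ refl ,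
  λ m → sym (trans (ℤP.*-identityˡ _) (act-zero -1ℤ Q (m - 0ℤ)))
selfReciprocalWitness⇒ (x ∷ P) []      _       = 0 , 1ℤ , inj₁ refl , λ m → act-zero -1ℤ (x ∷ P) m
selfReciprocalWitness⇒ (x ∷ P) (y ∷ Q) (k , w) = k , witness⇒reciprocal x P y Q k w

⇒selfReciprocalWitness : ∀ P Q {k ε} → NonZeroPoly P → NonZeroPoly Q → IsSign ε → Reciprocal P Q k ε → SelfReciprocalWitness P Q
⇒selfReciprocalWitness []      Q       (_ , nz) nzQ      sg r = contradiction refl nz
⇒selfReciprocalWitness (x ∷ P) []      nzP      (_ , nz) sg r = contradiction refl nz
⇒selfReciprocalWitness (x ∷ P) (y ∷ Q) {k}      nzP      nzQ sg r = k , reciprocal⇒witness x P y Q k sg r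

module _ (es : List ℕ) (es>0 : All (0 ℕ.<_) es) (f : Series) (H : Poly)
         (rational : act 1ℤ (prodOneMinus es) (ext f) ≗ act 1ℤ H δ) where

  private
    D : Poly
    D = prodOneMinus es

    M : ℤ
    M = + sum es

    D-nonZero : NonZeroPoly D
    D-nonZero = prodOneMinus-nonZero es es>0

  -- The hypothesis reads q^M H(1/q) = q^k H(q), and D(1/q) is D(q) up to sign and the factor
  -- q^(-M). The powers of q^M cancel in H / D and leave q^k.
  numeratorSymmetry⇒selfReciprocal : ∀ k → NonZeroPoly H → (∀ m → act -1ℤ H δ (m - M) ≡ act 1ℤ H δ (m - + k)) → SelfReciprocal f
  numeratorSymmetry⇒selfReciprocal k H-nonZero sym-H = H , D , D-nonZero , product ,
    ⇒selfReciprocalWitness H D H-nonZero D-nonZero (sgn-sign es) reciprocal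
    where
    product : mulPS D f ≈S coeff H
    product m = trans (sym (act-ext D f (+ m))) (trans (rational (+ m)) (act-δ H (+ m)))
    sym-H′ : ∀ m → act -1ℤ H δ m ≡ act 1ℤ H δ (m - (+ k - M))
    sym-H′ m = trans (cong (act -1ℤ H δ) (index₁ m M)) (trans (sym-H (m + M)) (cong (act 1ℤ H δ) (index₂ m M (+ k))))
      where
      index₁ : ∀ m M → m ≡ m + M - M
      index₁ = solve-∀
      index₂ : ∀ m M k → m + M - k ≡ m - (k - M)
      index₂ = solve-∀
    reciprocal : Reciprocal H D k (sgn es)
    reciprocal m = begin
      act -1ℤ H (act 1ℤ D δ) m
        ≡⟨ act-comm -1ℤ H 1ℤ D δ m ⟩
      act 1ℤ D (act -1ℤ H δ) m
        ≡⟨ act-cong 1ℤ D sym-H′ m ⟩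
      act 1ℤ D (λ i → act 1ℤ H δ (i - (+ k - M))) m
        ≡⟨ act-shift 1ℤ D (act 1ℤ H δ) (+ k - M) m ⟩
      act 1ℤ D (act 1ℤ H δ) (m - (+ k - M))
        ≡⟨ cong (act 1ℤ D (act 1ℤ H δ)) (index m M (+ k)) ⟩
      act 1ℤ D (act 1ℤ H δ) (m - + k + M)
        ≡⟨ square-sign (sgn-sign es) _ ⟩
      sgn es * (sgn es * act 1ℤ D (act 1ℤ H δ) (m - + k + M))
        ≡⟨ cong (sgn es *_) (sym (act-prodOneMinus-inverse es (act 1ℤ H δ) (m - + k))) ⟩
      sgn es * act -1ℤ D (act 1ℤ H δ) (m - + k) ∎
      where
      open ≡-Reasoning
      index : ∀ m M k → m - (k - M) ≡ m - k + M
      index = solve-∀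
      square-sign : ∀ {ε} → IsSign ε → ∀ x → x ≡ ε * (ε * x)
      square-sign (inj₁ refl) x = lemma x
        where
        lemma : ∀ x → x ≡ 1ℤ * (1ℤ * x)
        lemma = solve-∀
      square-sign (inj₂ refl) x = lemma x
        where
        lemma : ∀ x → x ≡ -1ℤ * (-1ℤ * x)
        lemma = solve-∀

  -- From P / Q = H / D follows D P = Q H. Reflecting this and inserting the reciprocity of P / Q
  -- shows that H(1/q) and ± q^(k - M) H(q) agree after multiplication by Q(q) Q(1/q) D(q), which is
  -- then cancelled.
  selfReciprocal⇒symmetry : ∀ f° → (∀ m → act 1ℤ D (ext f°) m ≡ act -1ℤ H δ (m - M)) → SelfReciprocal f →
    ∃[ k ] ∃[ ε ] IsSign ε × (∀ m → ext f° m ≡ ε * ext f (m - + k))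
  selfReciprocal⇒symmetry f° rational° (P , Q , Q-nonZero , product , witness) with selfReciprocalWitness⇒ P Q witness
  ... | k , ε , ε-sign , reciprocal = k , ε * sgn es , *-sign ε-sign (sgn-sign es) , f-symmetry
    where
    open ≡-Reasoning
    η = ε * sgn es
    u = + k - M
    F = ext f
    QF : act 1ℤ Q F ≗ act 1ℤ P δ
    QF m = trans (act-ext Q f m) (trans (ext-cong product m) (sym (act-δ P m)))
    DP : act 1ℤ D (act 1ℤ P δ) ≗ act 1ℤ Q (act 1ℤ H δ)
    DP m = begin
      act 1ℤ D (act 1ℤ P δ) m  ≡⟨ act-cong 1ℤ D (λ i → sym (QF i)) m ⟩
      act 1ℤ D (act 1ℤ Q F) m  ≡⟨ act-comm 1ℤ D 1ℤ Q F m ⟩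
      act 1ℤ Q (act 1ℤ D F) m  ≡⟨ act-cong 1ℤ Q rational m ⟩
      act 1ℤ Q (act 1ℤ H δ) m  ∎
    reflect² : ∀ A B m → act -1ℤ A (act -1ℤ B δ) m ≡ act 1ℤ A (act 1ℤ B δ) (- m)
    reflect² A B m = trans (act-cong -1ℤ A (act-reflect-δ -1ℤ B) m) (act-reflect -1ℤ A (act 1ℤ B δ) m)
    DP* : act -1ℤ D (act -1ℤ P δ) ≗ act -1ℤ Q (act -1ℤ H δ)
    DP* m = trans (reflect² D P m) (trans (DP (- m)) (sym (reflect² Q H m)))
    X Y : ℤ → ℤ
    X = act -1ℤ H δ
    Y m = η * act 1ℤ H δ (m - u)
    commuted : ∀ m → act 1ℤ Q (act -1ℤ Q (act 1ℤ D X)) m ≡ act 1ℤ Q (act -1ℤ Q (act 1ℤ D Y)) m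
    commuted m = begin
      act 1ℤ Q (act -1ℤ Q (act 1ℤ D X)) m
        ≡⟨ act-cong 1ℤ Q (act-comm -1ℤ Q 1ℤ D X) m ⟩
      act 1ℤ Q (act 1ℤ D (act -1ℤ Q X)) m
        ≡⟨ act-comm 1ℤ Q 1ℤ D (act -1ℤ Q X) m ⟩
      act 1ℤ D (act 1ℤ Q (act -1ℤ Q X)) m
        ≡⟨ act-cong 1ℤ D (act-cong 1ℤ Q (λ i → sym (DP* i))) m ⟩
      act 1ℤ D (act 1ℤ Q (act -1ℤ D (act -1ℤ P δ))) m
        ≡⟨ act-cong 1ℤ D (act-comm 1ℤ Q -1ℤ D (act -1ℤ P δ)) m ⟩
      act 1ℤ D (act -1ℤ D (act 1ℤ Q (act -1ℤ P δ))) m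
        ≡⟨ act-cong 1ℤ D (act-cong -1ℤ D (act-comm 1ℤ Q -1ℤ P δ)) m ⟩
      act 1ℤ D (act -1ℤ D (act -1ℤ P (act 1ℤ Q δ))) m
        ≡⟨ act-cong 1ℤ D (act-cong -1ℤ D reciprocal) m ⟩
      act 1ℤ D (act -1ℤ D (λ i → ε * act -1ℤ Q (act 1ℤ P δ) (i - + k))) m
        ≡⟨ act-cong 1ℤ D (act-prodOneMinus-inverse es _) m ⟩
      act 1ℤ D (λ i → sgn es * act 1ℤ D (λ i → ε * act -1ℤ Q (act 1ℤ P δ) (i - + k)) (i + M)) m
        ≡⟨ act-cong 1ℤ D inner m ⟩
      act 1ℤ D (λ i → η * act -1ℤ Q (act 1ℤ Q (act 1ℤ H δ)) (i - u)) m
        ≡⟨ act-cong 1ℤ D (λ i → cong (η *_) (act-comm -1ℤ Q 1ℤ Q (act 1ℤ H δ) (i - u))) m ⟩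
      act 1ℤ D (λ i → η * act 1ℤ Q (act -1ℤ Q (act 1ℤ H δ)) (i - u)) m
        ≡⟨ act-cong 1ℤ D (λ i → sym (affine 1ℤ Q (act -1ℤ Q (act 1ℤ H δ)) i)) m ⟩
      act 1ℤ D (act 1ℤ Q (λ i → η * act -1ℤ Q (act 1ℤ H δ) (i - u))) m
        ≡⟨ act-cong 1ℤ D (act-cong 1ℤ Q (λ i → sym (affine -1ℤ Q (act 1ℤ H δ) i))) m ⟩
      act 1ℤ D (act 1ℤ Q (act -1ℤ Q Y)) m
        ≡⟨ act-comm 1ℤ D 1ℤ Q (act -1ℤ Q Y) m ⟩
      act 1ℤ Q (act 1ℤ D (act -1ℤ Q Y)) m
        ≡⟨ act-cong 1ℤ Q (act-comm 1ℤ D -1ℤ Q Y) m ⟩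
      act 1ℤ Q (act -1ℤ Q (act 1ℤ D Y)) m ∎
      where
      affine : ∀ t A g i → act t A (λ j → η * g (j - u)) i ≡ η * act t A g (i - u)
      affine t A g i = trans (act-scale t A η (λ j → g (j - u)) i) (cong (η *_) (act-shift t A g u i))
      inner : ∀ i → sgn es * act 1ℤ D (λ i → ε * act -1ℤ Q (act 1ℤ P δ) (i - + k)) (i + M)
                  ≡ η * act -1ℤ Q (act 1ℤ Q (act 1ℤ H δ)) (i - u)
      inner i = begin
        sgn es * act 1ℤ D (λ i → ε * G (i - + k)) (i + M)
          ≡⟨ cong (sgn es *_) (act-scale 1ℤ D ε (λ i → G (i - + k)) (i + M)) ⟩
        sgn es * (ε * act 1ℤ D (λ i → G (i - + k)) (i + M))
          ≡⟨ cong (λ x → sgn es * (ε * x)) (act-shift 1ℤ D G (+ k) (i + M)) ⟩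
        sgn es * (ε * act 1ℤ D G (i + M - + k))
          ≡⟨ cong (λ x → sgn es * (ε * x)) (act-comm 1ℤ D -1ℤ Q (act 1ℤ P δ) (i + M - + k)) ⟩
        sgn es * (ε * act -1ℤ Q (act 1ℤ D (act 1ℤ P δ)) (i + M - + k))
          ≡⟨ cong (λ x → sgn es * (ε * x)) (act-cong -1ℤ Q DP (i + M - + k)) ⟩
        sgn es * (ε * act -1ℤ Q (act 1ℤ Q (act 1ℤ H δ)) (i + M - + k))
          ≡⟨ cong (λ j → sgn es * (ε * act -1ℤ Q (act 1ℤ Q (act 1ℤ H δ)) j)) (index i M (+ k)) ⟩
        sgn es * (ε * act -1ℤ Q (act 1ℤ Q (act 1ℤ H δ)) (i - u))
          ≡⟨ regroup (sgn es) ε _ ⟩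
        η * act -1ℤ Q (act 1ℤ Q (act 1ℤ H δ)) (i - u) ∎
        where
        G = act -1ℤ Q (act 1ℤ P δ)
        index : ∀ i M k → i + M - k ≡ i - (k - M)
        index = solve-∀
        regroup : ∀ s e x → s * (e * x) ≡ e * s * x
        regroup = solve-∀
    X-finite : FiniteSupport X
    X-finite = act-finite -1ℤ H δ-finite
    Y-finite : FiniteSupport Y
    Y-finite = scale-finite η (shift-finite u (act-finite 1ℤ H δ-finite))
    X≗Y : X ≗ Y
    X≗Y = act-cancel-finite D D-nonZero X-finite Y-finite
      (act*-cancel-finite Q Q-nonZero (act-finite 1ℤ D X-finite) (act-finite 1ℤ D Y-finite)
        (act-cancel-finite Q Q-nonZero (act-finite -1ℤ Q (act-finite 1ℤ D X-finite))
          (act-finite -1ℤ Q (act-finite 1ℤ D Y-finite)) commuted))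
    D-symmetry : act 1ℤ D (ext f°) ≗ act 1ℤ D (λ m → η * F (m - + k))
    D-symmetry m = begin
      act 1ℤ D (ext f°) m                   ≡⟨ rational° m ⟩
      X (m - M)                             ≡⟨ X≗Y (m - M) ⟩
      η * act 1ℤ H δ (m - M - u)            ≡⟨ cong (λ i → η * act 1ℤ H δ i) (index m M (+ k)) ⟩
      η * act 1ℤ H δ (m - + k)              ≡⟨ cong (η *_) (sym (rational (m - + k))) ⟩
      η * act 1ℤ D F (m - + k)              ≡⟨ cong (η *_) (sym (act-shift 1ℤ D F (+ k) m)) ⟩
      η * act 1ℤ D (λ m → F (m - + k)) m    ≡⟨ sym (act-scale 1ℤ D η (λ m → F (m - + k)) m) ⟩
      act 1ℤ D (λ m → η * F (m - + k)) m    ∎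
      where
      index : ∀ m M k → m - M - (k - M) ≡ m - k
      index = solve-∀
    -- Both series vanish at negative indices, which suffices for cancelling D, as it acts by
    -- positive powers of q.
    f-symmetry : ∀ m → ext f° m ≡ η * F (m - + k)
    f-symmetry = act-cancel D (ext f°) _ 0ℤ D-nonZero (ext-below f°)
      (λ i lt → trans (cong (η *_) (ext-below f (i - + k) (ℤP.≤-<-trans (ℤP.i-j≤i i (+ k)) lt))) (ℤP.*-zeroʳ η))
      D-symmetry

-- The numerator is 1, so its symmetry is q^M = q^k, with k the sum of the exponents.
productForm⇒selfReciprocal : ∀ n f → IsProductForm n f → SelfReciprocal f
productForm⇒selfReciprocal n f (es , _ , es>0 , product) =
  numeratorSymmetry⇒selfReciprocal es es>0 f (1ℤ ∷ [])
    (λ m → trans (act-ext (prodOneMinus es) f m) (trans (ext-cong product m) (sym (unit 1ℤ m))))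
    (sum es) (0 , λ ()) (λ m → trans (unit -1ℤ (m - + sum es)) (sym (unit 1ℤ (m - + sum es))))
  where
  unit : ∀ t m → act t (1ℤ ∷ []) δ m ≡ δ m
  unit t m = trans (ℤP.+-identityʳ _) (ℤP.*-identityˡ (δ m))

-- Counting lattice points

module _ {A B : Set} (φ : A → B) where

  private
    delete : ∀ {y} ys zs {x : B} → x ∈ ys ++ y ∷ zs → x ≢ y → x ∈ ys ++ zs
    delete ys zs x∈ x≢y with ∈-++⁻ ys x∈
    ... | inj₁ x∈ys         = ∈-++⁺ˡ x∈ys
    ... | inj₂ (here x≡y)   = contradiction x≡y x≢y
    ... | inj₂ (there x∈zs) = ∈-++⁺ʳ ys x∈zs

    length-insert : ∀ ys {y : B} zs → length (ys ++ y ∷ zs) ≡ suc (length (ys ++ zs))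
    length-insert []       zs = refl
    length-insert (_ ∷ ys) zs = cong suc (length-insert ys zs)

  injection-length : ∀ {xs ys} → Unique xs → (∀ {x} → x ∈ xs → φ x ∈ ys) →
    (∀ {x x′} → x ∈ xs → x′ ∈ xs → φ x ≡ φ x′ → x ≡ x′) → length xs ℕ.≤ length ys
  injection-length {[]}     []         into inj = ℕ.z≤n
  injection-length {x ∷ xs} (x∉xs ∷ u) into inj with ∈-∃++ (into (here refl))
  ... | ys , zs , refl = subst (suc (length xs) ℕ.≤_) (sym (length-insert ys zs))
    (ℕ.s≤s (injection-length u
      (λ x′∈ → delete ys zs (into (there x′∈)) (λ eq → All.lookup x∉xs x′∈ (inj (here refl) (there x′∈) (sym eq))))
      (λ x∈ x′∈ → inj (there x∈) (there x′∈))))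

  injection-length-< : ∀ {xs ys y} → Unique xs → (∀ {x} → x ∈ xs → φ x ∈ ys) →
    (∀ {x x′} → x ∈ xs → x′ ∈ xs → φ x ≡ φ x′ → x ≡ x′) →
    y ∈ ys → (∀ {x} → x ∈ xs → φ x ≢ y) → length xs ℕ.< length ys
  injection-length-< {xs} u into inj y∈ missed with ∈-∃++ y∈
  ... | ys , zs , refl = subst (suc (length xs) ℕ.≤_) (sym (length-insert ys zs))
    (ℕ.s≤s (injection-length u (λ x∈ → delete ys zs (into x∈) (missed x∈)) inj))

tuples-product : ∀ n m → tuples (suc n) m ≡ cartesianProductWith _∷_ (upTo (suc m)) (tuples n m)
tuples-product n m = go (upTo (suc m))
  where
  go : ∀ xs → concatMap (λ x → map (x ∷_) (tuples n m)) xs ≡ cartesianProductWith _∷_ xs (tuples n m)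
  go []       = refl
  go (x ∷ xs) = cong (map (x ∷_) (tuples n m) ++_) (go xs)

tuples-unique : ∀ n m → Unique (tuples n m)
tuples-unique zero    m = [] ∷ []
tuples-unique (suc n) m = subst Unique (sym (tuples-product n m))
  (Unique.cartesianProductWith⁺ _∷_ LP.∷-injective (Unique.upTo⁺ (suc m)) (tuples-unique n m))

∈-tuples⁺ : ∀ n m {xs} → length xs ≡ n → All (ℕ._≤ m) xs → xs ∈ tuples n m
∈-tuples⁺ zero    m {[]}     len []           = here refl
∈-tuples⁺ (suc n) m {x ∷ xs} len (x≤m ∷ xs≤m) = subst (x ∷ xs ∈_) (sym (tuples-product n m))
  (∈-cartesianProductWith⁺ _∷_ (∈-upTo⁺ (ℕ.s≤s x≤m)) (∈-tuples⁺ n m (ℕP.suc-injective len) xs≤m))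

∈-tuples⁻ : ∀ n m {xs} → xs ∈ tuples n m → length xs ≡ n
∈-tuples⁻ zero    m (here refl) = refl
∈-tuples⁻ (suc n) m {xs} xs∈ with ∈-cartesianProductWith⁻ _∷_ (upTo (suc m)) (tuples n m) (subst (xs ∈_) (tuples-product n m) xs∈)
... | _ , _ , _ , ys∈ , refl = cong suc (∈-tuples⁻ n m ys∈)

all≤sum : ∀ xs → All (ℕ._≤ sum xs) xs
all≤sum []       = []
all≤sum (x ∷ xs) = ℕP.m≤m+n x (sum xs) ∷ All.map (λ le → ℕP.≤-trans le (ℕP.m≤n+m (sum xs) x)) (all≤sum xs)

points : (List ℕ → Bool) → ℕ → ℕ → List (List ℕ)
points C n m = filterᵇ (λ xs → C xs ∧ (sum xs ℕ.≡ᵇ m)) (tuples n m)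

points-unique : ∀ C n m → Unique (points C n m)
points-unique C n m = Unique.filter⁺ _ (tuples-unique n m)

∈-points⁺ : ∀ C {n m xs} → length xs ≡ n → T (C xs) → sum xs ≡ m → xs ∈ points C n m
∈-points⁺ C {n} {m} {xs} len c refl = ∈-filter⁺ _ (∈-tuples⁺ n m len (all≤sum xs))
  (Equivalence.from T-∧ (c , ℕP.≡⇒≡ᵇ (sum xs) (sum xs) refl))

∈-points⁻ : ∀ C {n m xs} → xs ∈ points C n m → length xs ≡ n × T (C xs) × sum xs ≡ m
∈-points⁻ C {n} {m} {xs} xs∈ with ∈-filter⁻ _ {xs = tuples n m} xs∈
... | xs∈tuples , c with Equivalence.to T-∧ c
... | c₁ , c₂ = ∈-tuples⁻ n m xs∈tuples , c₁ , ℕP.≡ᵇ⇒≡ (sum xs) m c₂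

number : (List ℕ → Bool) → ℕ → ℕ → ℕ
number C n m = length (points C n m)

number-mono : ∀ C C′ n m → (∀ {xs} → length xs ≡ n → T (C xs) → T (C′ xs)) → number C n m ℕ.≤ number C′ n m
number-mono C C′ n m imp = injection-length id (points-unique C n m)
  (λ xs∈ → let len , c , s = ∈-points⁻ C {n} xs∈ in ∈-points⁺ C′ len (imp len c) s)
  (λ _ _ eq → eq)

-- A tuple (λ₁,…,λₙ) is viewed as a function with λ₀ = 0.
entry : List ℕ → ℕ → ℕ
entry []       i       = 0
entry (x ∷ xs) zero    = x
entry (x ∷ xs) (suc i) = entry xs i

pt : List ℕ → ℕ → ℤ
pt xs zero    = 0ℤ
pt xs (suc i) = + entry xs i

tab : ℕ → (ℕ → ℤ) → List ℕ
tab n f = applyUpTo (λ i → ∣ f (suc i) ∣) n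

total : ℕ → (ℕ → ℤ) → ℤ
total zero    g = 0ℤ
total (suc n) g = g 0 + total n (g ∘ suc)

weight : ℕ → (ℕ → ℤ) → ℤ
weight n f = total n (f ∘ suc)

entry-applyUpTo : ∀ g n i → i ℕ.< n → entry (applyUpTo g n) i ≡ g i
entry-applyUpTo g (suc n) zero    lt         = refl
entry-applyUpTo g (suc n) (suc i) (ℕ.s≤s lt) = entry-applyUpTo (g ∘ suc) n i lt

entry-extensional : ∀ n {xs ys} → length xs ≡ n → length ys ≡ n → (∀ i → i ℕ.< n → entry xs i ≡ entry ys i) → xs ≡ ys
entry-extensional zero    {[]}     {[]}     p q e = refl
entry-extensional (suc n) {x ∷ xs} {y ∷ ys} p q e = cong₂ _∷_ (e 0 (ℕ.s≤s ℕ.z≤n))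
  (entry-extensional n (ℕP.suc-injective p) (ℕP.suc-injective q) (λ i lt → e (suc i) (ℕ.s≤s lt)))

total-cong : ∀ n {g h} → (∀ i → i ℕ.< n → g i ≡ h i) → total n g ≡ total n h
total-cong zero    e = refl
total-cong (suc n) e = cong₂ _+_ (e 0 (ℕ.s≤s ℕ.z≤n)) (total-cong n (λ i lt → e (suc i) (ℕ.s≤s lt)))

total-linear : ∀ n a g h → total n (λ i → a * g i + h i) ≡ a * total n g + total n h
total-linear zero    a g h = sym (trans (ℤP.+-identityʳ (a * 0ℤ)) (ℤP.*-zeroʳ a))
total-linear (suc n) a g h = trans (cong (_+_ (a * g 0 + h 0)) (total-linear n a (g ∘ suc) (h ∘ suc)))
  (regroup a (g 0) (h 0) (total n (g ∘ suc)) (total n (h ∘ suc)))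
  where
  regroup : ∀ a x y u v → a * x + y + (a * u + v) ≡ a * (x + u) + (y + v)
  regroup = solve-∀

total-zero : ∀ n → total n (λ _ → 0ℤ) ≡ 0ℤ
total-zero zero    = refl
total-zero (suc n) = trans (ℤP.+-identityˡ _) (total-zero n)

total-nonNeg : ∀ n {g} → (∀ i → i ℕ.< n → 0ℤ ≤ g i) → 0ℤ ≤ total n g
total-nonNeg zero    z = ℤP.≤-refl
total-nonNeg (suc n) z = ℤP.+-mono-≤ (z 0 (ℕ.s≤s ℕ.z≤n)) (total-nonNeg n (λ i lt → z (suc i) (ℕ.s≤s lt)))

total-pos : ∀ n {g} → (∀ i → i ℕ.< n → 0ℤ ≤ g i) → ∀ j → j ℕ.< n → 0ℤ < g j → 0ℤ < total n g
total-pos (suc n) z zero    lt         p = ℤP.+-mono-<-≤ p (total-nonNeg n (λ i lt → z (suc i) (ℕ.s≤s lt)))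
total-pos (suc n) z (suc j) (ℕ.s≤s lt) p = ℤP.+-mono-≤-< (z 0 (ℕ.s≤s ℕ.z≤n))
  (total-pos n (λ i lt → z (suc i) (ℕ.s≤s lt)) j lt p)

total-entry : ∀ n xs → length xs ≡ n → total n (λ i → + entry xs i) ≡ + sum xs
total-entry zero    []     p = refl
total-entry (suc n) (x ∷ xs) p = cong (_+_ (+ x)) (total-entry n xs (ℕP.suc-injective p))

pt-tab : ∀ n {f} → f 0 ≡ 0ℤ → (∀ i → i ℕ.≤ n → 0ℤ ≤ f i) → ∀ i → i ℕ.≤ n → pt (tab n f) i ≡ f i
pt-tab n {f} f0 z zero    le = sym f0
pt-tab n {f} f0 z (suc i) le = trans (cong +_ (entry-applyUpTo (λ i → ∣ f (suc i) ∣) n i le)) (ℤP.0≤i⇒+∣i∣≡i (z (suc i) le))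

pt-injective : ∀ n {xs ys} → length xs ≡ n → length ys ≡ n → (∀ i → i ℕ.≤ n → pt xs i ≡ pt ys i) → xs ≡ ys
pt-injective n p q e = entry-extensional n p q (λ i lt → ℤP.+-injective (e (suc i) lt))

*-nonNeg : ∀ {x y} → 0ℤ ≤ x → 0ℤ ≤ y → 0ℤ ≤ x * y
*-nonNeg {x} {y} 0≤x 0≤y = subst (_≤ x * y) (ℤP.*-zeroʳ x) (ℤP.*-monoˡ-≤-nonNeg x {{ℤ.nonNegative 0≤x}} 0≤y)

*-pos : ∀ {x y} → 0ℤ < x → 0ℤ < y → 0ℤ < x * y
*-pos {x} {y} 0<x 0<y = subst (_< x * y) (ℤP.*-zeroʳ x) (ℤP.*-monoˡ-<-pos x {{ℤ.positive 0<x}} 0<y)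

-- Integer points with conditions on their facet values

module Cone (σ : ℕ → ℤ) (σ>0 : ∀ i → 0ℤ < σ i) where

  -- σ 0 = 1 and λ₀ = 0 make λ₁ ≥ 0 the facet inequality of index 0.
  facet : (ℕ → ℤ) → ℕ → ℤ
  facet f i = f (suc i) * σ i - f i * σ (suc i)

  Norm : ℕ → ℤ
  Norm i = σ (suc i) * σ i

  facet-linear : ∀ a f g i → facet (λ k → a * f k + g k) i ≡ a * facet f i + facet g i
  facet-linear a f g i = regroup a (f (suc i)) (f i) (g (suc i)) (g i) (σ i) (σ (suc i))
    where
    regroup : ∀ a x y u v s t → (a * x + u) * s - (a * y + v) * t ≡ a * (x * s - y * t) + (u * s - v * t)
    regroup = solve-∀

  -- Here κₖ is the quotient λₖ / σₖ, so facet values are its increments scaled by `Norm`. An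
  -- integer κ with chosen jumps thus prescribes facet values in multiples of `Norm`.
  facet-scaled : ∀ (κ : ℕ → ℤ) i → facet (λ k → σ k * κ k) i ≡ Norm i * (κ (suc i) - κ i)
  facet-scaled κ i = regroup (σ i) (σ (suc i)) (κ i) (κ (suc i))
    where
    regroup : ∀ s t x y → t * y * s - s * x * t ≡ t * s * (y - x)
    regroup = solve-∀

  Norm>0 : ∀ i → 0ℤ < Norm i
  Norm>0 i = *-pos (σ>0 (suc i)) (σ>0 i)

  facets-nonNeg⇒nonNeg : ∀ n f → f 0 ≡ 0ℤ → (∀ i → i ℕ.< n → 0ℤ ≤ facet f i) → ∀ i → i ℕ.≤ n → 0ℤ ≤ f i
  facets-nonNeg⇒nonNeg n f f0 z zero    le = ℤP.≤-reflexive (sym f0)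
  facets-nonNeg⇒nonNeg n f f0 z (suc i) le = ℤP.*-cancelʳ-≤-pos 0ℤ (f (suc i)) (σ i) {{ℤ.positive (σ>0 i)}}
    (ℤP.≤-trans (*-nonNeg (facets-nonNeg⇒nonNeg n f f0 z i (ℕP.<⇒≤ le)) (ℤP.<⇒≤ (σ>0 (suc i))))
                (ℤP.0≤i-j⇒j≤i (z i le)))

  -- A condition on each facet value separately. It is decidable so that points can be counted, and
  -- it forces nonnegativity because the enumeration ranges over tuples of naturals.
  record Faces : Set₁ where
    field
      Holds  : ℕ → ℤ → Set
      holds? : ∀ i x → Dec (Holds i x)
      nonNeg : ∀ {i x} → Holds i x → 0ℤ ≤ x

  open Faces public

  Region : Faces → ℕ → (ℕ → ℤ) → Set
  Region G n f = ∀ i → i ℕ.< n → Holds G i (facet f i)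

  region? : ∀ G n f → Dec (Region G n f)
  region? G n f = map′ (λ r i lt → r lt) (λ r {i} lt → r i lt) (ℕP.allUpTo? (λ i → holds? G i (facet f i)) n)

  inRegion : Faces → ℕ → List ℕ → Bool
  inRegion G n xs = isYes (region? G n (pt xs))

  cardinality : Faces → ℕ → Series
  cardinality G n m = + number (inRegion G n) n m

  region-cong : ∀ G n f g → (∀ i → i ℕ.≤ n → f i ≡ g i) → Region G n f → Region G n g
  region-cong G n f g e rf i lt = subst (Holds G i)
    (cong₂ (λ x y → x * σ i - y * σ (suc i)) (e (suc i) lt) (e i (ℕP.<⇒≤ lt))) (rf i lt)

  region-nonNeg : ∀ G n f → f 0 ≡ 0ℤ → Region G n f → ∀ i → i ℕ.≤ n → 0ℤ ≤ f i
  region-nonNeg G n f f0 rf = facets-nonNeg⇒nonNeg n f f0 (λ i lt → nonNeg G (rf i lt))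

  ∈-region⁺ : ∀ G n f {m} → f 0 ≡ 0ℤ → Region G n f → weight n f ≡ + m → tab n f ∈ points (inRegion G n) n m
  ∈-region⁺ G n f {m} f0 rf wf = ∈-points⁺ (inRegion G n) len
    (fromWitness {a? = region? G n (pt (tab n f))} (region-cong G n f (pt (tab n f)) (λ i le → sym (agree i le)) rf)) (ℤP.+-injective total-tab)
    where
    agree : ∀ i → i ℕ.≤ n → pt (tab n f) i ≡ f i
    agree = pt-tab n f0 (region-nonNeg G n f f0 rf)
    len : length (tab n f) ≡ n
    len = LP.length-applyUpTo (λ i → ∣ f (suc i) ∣) n
    total-tab : + sum (tab n f) ≡ + m
    total-tab = trans (sym (total-entry n (tab n f) len)) (trans (total-cong n (λ i lt → agree (suc i) lt)) wf)

  ∈-region⁻ : ∀ G n {xs m} → xs ∈ points (inRegion G n) n m → length xs ≡ n × Region G n (pt xs) × weight n (pt xs) ≡ + m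
  ∈-region⁻ G n {xs} xs∈ with ∈-points⁻ (inRegion G n) {n} xs∈
  ... | len , c , s = len , toWitness {a? = region? G n (pt xs)} c , trans (total-entry n xs len) (cong +_ s)

  module _ (n : ℕ) (ε : ℤ) (ε-sign : IsSign ε) (u : ℕ → ℤ) (u0 : u 0 ≡ 0ℤ) where

    affine : (ℕ → ℤ) → ℕ → ℤ
    affine f k = ε * f k + u k

    weight-affine : ∀ f → weight n (affine f) ≡ ε * weight n f + weight n u
    weight-affine f = total-linear n ε (f ∘ suc) (u ∘ suc)

    affine-0 : ∀ xs → affine (pt xs) 0 ≡ 0ℤ
    affine-0 xs = cong₂ _+_ (ℤP.*-zeroʳ ε) u0

    affine-injective : ∀ {x y} k → ε * x + u k ≡ ε * y + u k → x ≡ y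
    affine-injective {x} {y} k e = *-cancel ε-sign (∙-cancelʳ (u k) (ε * x) (ε * y) e)
      where
      *-cancel : ∀ {ε} → IsSign ε → ε * x ≡ ε * y → x ≡ y
      *-cancel (inj₁ refl) e = ℤP.*-cancelˡ-≡ 1ℤ x y e
      *-cancel (inj₂ refl) e = ℤP.*-cancelˡ-≡ -1ℤ x y e

    module _ (G G′ : Faces) (maps : ∀ {i x} → i ℕ.< n → Holds G i x → Holds G′ i (ε * x + facet u i)) where

      affine-region : ∀ f → Region G n f → Region G′ n (affine f)
      affine-region f rf i lt = subst (Holds G′ i) (sym (facet-linear ε f u i)) (maps lt (rf i lt))

      affine-∈ : ∀ {m m′} → ε * + m + weight n u ≡ + m′ → ∀ {xs} →
        xs ∈ points (inRegion G n) n m → tab n (affine (pt xs)) ∈ points (inRegion G′ n) n m′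
      affine-∈ {m} e {xs} xs∈ with ∈-region⁻ G n {m = m} xs∈
      ... | len , rx , wx = ∈-region⁺ G′ n (affine (pt xs)) (affine-0 xs) (affine-region (pt xs) rx)
        (trans (weight-affine (pt xs)) (trans (cong (λ x → ε * x + weight n u) wx) e))

      affine-tab-injective : ∀ {m xs ys} → xs ∈ points (inRegion G n) n m → ys ∈ points (inRegion G n) n m →
        tab n (affine (pt xs)) ≡ tab n (affine (pt ys)) → xs ≡ ys
      affine-tab-injective {m} {xs} {ys} xs∈ ys∈ e with ∈-region⁻ G n {m = m} xs∈ | ∈-region⁻ G n {m = m} ys∈
      ... | lx , rx , _ | ly , ry , _ = pt-injective n lx ly (λ i le → affine-injective i
        (trans (sym (agree xs rx i le)) (trans (cong (λ zs → pt zs i) e) (agree ys ry i le))))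
        where
        agree : ∀ zs → Region G n (pt zs) → ∀ i → i ℕ.≤ n → pt (tab n (affine (pt zs))) i ≡ affine (pt zs) i
        agree zs rz = pt-tab n (affine-0 zs) (region-nonNeg G′ n (affine (pt zs)) (affine-0 zs) (affine-region (pt zs) rz))

      cardinality-≤ : ∀ m → ext (cardinality G n) m ≤ ext (cardinality G′ n) (ε * m + weight n u)
      cardinality-≤ -[1+ m ] = ext-nonNeg (ε * -[1+ m ] + weight n u)
        where
        ext-nonNeg : ∀ i → 0ℤ ≤ ext (cardinality G′ n) i
        ext-nonNeg (+ i)    = ℤ.+≤+ ℕ.z≤n
        ext-nonNeg -[1+ i ] = ℤP.≤-refl
      cardinality-≤ (+ m) with ε * + m + weight n u in eq
      ... | + m′ = ℤ.+≤+ (injection-length (λ xs → tab n (affine (pt xs))) (points-unique (inRegion G n) n m)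
        (affine-∈ {m} eq) (affine-tab-injective {m}))
      -- Image points have nonnegative weight, so a negative target degree means that the source
      -- degree is empty.
      ... | -[1+ m′ ] = ℤ.+≤+ (empty (points (inRegion G n) n m) refl)
        where
        empty : ∀ ps → ps ≡ points (inRegion G n) n m → length ps ℕ.≤ 0
        empty []       _ = ℕ.z≤n
        empty (xs ∷ ps) e with ∈-region⁻ G n {m = m} (subst (xs ∈_) e (here refl))
        ... | len , rx , wx = ⊥-elim (0≰- (subst (0ℤ ≤_)
          (trans (weight-affine (pt xs)) (trans (cong (λ x → ε * x + weight n u) wx) eq))
          (total-nonNeg n (λ i lt → region-nonNeg G′ n (affine (pt xs)) (affine-0 xs) (affine-region (pt xs) rx) (suc i) lt))))
          where
          0≰- : ¬ (0ℤ ≤ -[1+ m′ ])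
          0≰- ()

  -- The map λ ↦ ε λ + u has the inverse λ ↦ ε λ - ε u of the same shape, so the injection bound
  -- applies both ways. Translations by a ray generator or an interior point and the reflection of
  -- the parallelepiped are all instances.
  cardinality-affine : ∀ n ε → IsSign ε → ∀ u → u 0 ≡ 0ℤ → ∀ G G′ →
    (∀ {i x} → i ℕ.< n → Holds G i x → Holds G′ i (ε * x + facet u i)) →
    (∀ {i x} → i ℕ.< n → Holds G′ i x → Holds G i (ε * (x - facet u i))) →
    ∀ m → ext (cardinality G n) m ≡ ext (cardinality G′ n) (ε * m + weight n u)
  cardinality-affine n ε ε-sign u u0 G G′ maps maps⁻¹ m = ℤP.≤-antisym
    (cardinality-≤ n ε ε-sign u u0 G G′ maps m)
    (subst (λ i → ext (cardinality G′ n) (ε * m + weight n u) ≤ ext (cardinality G n) i) index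
      (cardinality-≤ n ε ε-sign u⁻¹ u⁻¹0 G′ G maps′ (ε * m + weight n u)))
    where
    u⁻¹ : ℕ → ℤ
    -- The added zero gives the form to which `facet-linear` and `total-linear` apply.
    u⁻¹ k = - ε * u k + 0ℤ
    u⁻¹0 : u⁻¹ 0 ≡ 0ℤ
    u⁻¹0 = trans (ℤP.+-identityʳ _) (trans (cong (- ε *_) u0) (ℤP.*-zeroʳ (- ε)))
    maps′ : ∀ {i x} → i ℕ.< n → Holds G′ i x → Holds G i (ε * x + facet u⁻¹ i)
    maps′ {i} {x} lt h = subst (Holds G i) (sym (trans (cong (_+_ (ε * x)) (facet-linear (- ε) u (λ _ → 0ℤ) i))
      (regroup ε x (facet u i) (σ i) (σ (suc i))))) (maps⁻¹ lt h)
      where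
      regroup : ∀ ε x y s t → ε * x + (- ε * y + (0ℤ * s - 0ℤ * t)) ≡ ε * (x - y)
      regroup = solve-∀
    index : ε * (ε * m + weight n u) + weight n u⁻¹ ≡ m
    index = trans (cong (_+_ (ε * (ε * m + weight n u)))
      (trans (total-linear n (- ε) (u ∘ suc) (λ _ → 0ℤ)) (cong (_+_ (- ε * weight n u)) (total-zero n))))
      (square ε-sign (weight n u))
      where
      square : ∀ {ε} → IsSign ε → ∀ w → ε * (ε * m + w) + (- ε * w + 0ℤ) ≡ m
      square (inj₁ refl) w = lemma m w
        where
        lemma : ∀ m w → 1ℤ * (1ℤ * m + w) + (-1ℤ * w + 0ℤ) ≡ m
        lemma = solve-∀
      square (inj₂ refl) w = lemma m w
        where
        lemma : ∀ m w → -1ℤ * (-1ℤ * m + w) + (1ℤ * w + 0ℤ) ≡ m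
        lemma = solve-∀

  cardinality-split : ∀ G G₁ G₂ n →
    (∀ f → Region G n f → Region G₁ n f ⊎ Region G₂ n f) →
    (∀ f → Region G₁ n f → Region G n f) → (∀ f → Region G₂ n f → Region G n f) →
    (∀ f → Region G₁ n f → ¬ Region G₂ n f) →
    ∀ m → cardinality G n m ≡ cardinality G₁ n m + cardinality G₂ n m
  cardinality-split G G₁ G₂ n cover incl₁ incl₂ disjoint m = cong +_ (trans (ℕP.≤-antisym
      (injection-length id (points-unique _ n m) into (λ _ _ e → e))
      (injection-length id unique from (λ _ _ e → e))) (LP.length-++ (P G₁)))
    where
    P : Faces → List (List ℕ)
    P G = points (inRegion G n) n m
    shrink : ∀ G G′ {xs} → (Region G n (pt xs) → Region G′ n (pt xs)) → xs ∈ P G → xs ∈ P G′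
    shrink G G′ {xs} imp xs∈ with ∈-points⁻ (inRegion G n) {n} xs∈
    ... | len , c , s = ∈-points⁺ (inRegion G′ n) len
      (fromWitness {a? = region? G′ n (pt xs)} (imp (toWitness {a? = region? G n (pt xs)} c))) s
    into : ∀ {xs} → xs ∈ P G → xs ∈ P G₁ ++ P G₂
    into {xs} xs∈ with cover (pt xs) (proj₁ (proj₂ (∈-region⁻ G n {m = m} xs∈)))
    ... | inj₁ r = ∈-++⁺ˡ (shrink G G₁ (λ _ → r) xs∈)
    ... | inj₂ r = ∈-++⁺ʳ (P G₁) (shrink G G₂ (λ _ → r) xs∈)
    from : ∀ {xs} → xs ∈ P G₁ ++ P G₂ → xs ∈ P G
    from {xs} xs∈ with ∈-++⁻ (P G₁) xs∈
    ... | inj₁ p = shrink G₁ G (incl₁ (pt xs)) p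
    ... | inj₂ p = shrink G₂ G (incl₂ (pt xs)) p
    unique : Unique (P G₁ ++ P G₂)
    unique = Unique.++⁺ (points-unique _ n m) (points-unique _ n m)
      (λ {xs} (p , q) → disjoint (pt xs) (proj₁ (proj₂ (∈-region⁻ G₁ n {m = m} p))) (proj₁ (proj₂ (∈-region⁻ G₂ n {m = m} q))))

-- Reciprocity for the lecture hall cone

i≤j⇒i≤j+nonNeg : ∀ {i j k} → i ≤ j → 0ℤ ≤ k → i ≤ j + k
i≤j⇒i≤j+nonNeg {i} {j} {k} i≤j 0≤k = subst (_≤ j + k) (ℤP.+-identityʳ i) (ℤP.+-mono-≤ i≤j 0≤k)

i+k≤j⇒i≤j-k : ∀ i k j → i + k ≤ j → i ≤ j - k
i+k≤j⇒i≤j-k i k j le = subst (_≤ j - k) (cancel i k) (ℤP.+-monoˡ-≤ (- k) le)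
  where
  cancel : ∀ i k → i + k - k ≡ i
  cancel = solve-∀

selfReciprocal-resp-≈S : ∀ {f g} → f ≈S g → SelfReciprocal f → SelfReciprocal g
selfReciprocal-resp-≈S {f} {g} e (P , Q , Q-nonZero , product , w) = P , Q , Q-nonZero ,
  (λ m → trans (sym (act-ext Q g (+ m))) (trans (act-cong 1ℤ Q (λ i → sym (ext-cong e i)) (+ m)) (trans (act-ext Q f (+ m)) (product m)))) , w

-- The indicator of k > r. Multiplied by σ it becomes the ray generator whose first nonzero entry
-- has index r + 1.
step : ℕ → ℕ → ℤ
step r       zero    = 0ℤ
step zero    (suc k) = 1ℤ
step (suc r) (suc k) = step r k

step-zero : ∀ r → step r 0 ≡ 0ℤ
step-zero zero    = refl
step-zero (suc r) = refl

step-refl : ∀ r → step r r ≡ 0ℤ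
step-refl zero    = refl
step-refl (suc r) = step-refl r

step-suc : ∀ r → step r (suc r) ≡ 1ℤ
step-suc zero    = refl
step-suc (suc r) = step-suc r

step-≢ : ∀ r i → i ≢ r → step r (suc i) ≡ step r i
step-≢ zero    zero    i≢r = contradiction refl i≢r
step-≢ zero    (suc i) i≢r = refl
step-≢ (suc r) zero    i≢r = step-zero r
step-≢ (suc r) (suc i) i≢r = step-≢ r i (i≢r ∘ cong suc)

step-nonNeg : ∀ r k → 0ℤ ≤ step r k
step-nonNeg r       zero    = ℤP.≤-refl
step-nonNeg zero    (suc k) = ℤ.+≤+ ℕ.z≤n
step-nonNeg (suc r) (suc k) = step-nonNeg r k

step-< : ∀ r k → r ℕ.< k → step r k ≡ 1ℤ
step-< zero    (suc k) lt         = refl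
step-< (suc r) (suc k) (ℕ.s≤s lt) = step-< r k lt

module Reciprocity (σ : ℕ → ℤ) (σ>0 : ∀ i → 0ℤ < σ i) (n : ℕ) where

  open Cone σ σ>0

  -- a = 0 gives the closed cone and a = 1 its interior; the first r facet
  -- coordinates are confined to a half-open period of the ray generators.
  kind : ℕ → ℕ → Faces
  kind a r = record
    { Holds  = λ i x → + a ≤ x × (i ℕ.< r → x < + a + Norm i)
    ; holds? = λ i x → (+ a ℤ.≤? x) ×-dec ((i ℕ.<? r) →-dec (x ℤ.<? + a + Norm i))
    ; nonNeg = λ (a≤x , _) → ℤP.≤-trans (ℤ.+≤+ ℕ.z≤n) a≤x
    }

  -- The part of `kind a r` that lies at least one period away in facet r.
  upper : ℕ → ℕ → Faces
  upper a r = record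
    { Holds  = λ i x → Holds (kind a r) i x × (i ≡ r → + a + Norm r ≤ x)
    ; holds? = λ i x → holds? (kind a r) i x ×-dec ((i ℕ.≟ r) →-dec (+ a + Norm r ℤ.≤? x))
    ; nonNeg = λ (h , _) → nonNeg (kind a r) h
    }

  ray : ℕ → ℕ → ℤ
  ray r k = σ k * step r k

  facet-ray-≡ : ∀ r → facet (ray r) r ≡ Norm r
  facet-ray-≡ r = trans (facet-scaled (step r) r)
    (trans (cong₂ (λ x y → Norm r * (x - y)) (step-suc r) (step-refl r)) (ℤP.*-identityʳ (Norm r)))

  facet-ray-≢ : ∀ r i → i ≢ r → facet (ray r) i ≡ 0ℤ
  facet-ray-≢ r i i≢r = trans (facet-scaled (step r) i)
    (trans (cong (λ x → Norm i * (x - step r i)) (step-≢ r i i≢r))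
           (trans (cong (Norm i *_) (ℤP.+-inverseʳ (step r i))) (ℤP.*-zeroʳ (Norm i))))

  ray-nonNeg : ∀ r k → 0ℤ ≤ ray r k
  ray-nonNeg r k = *-nonNeg (ℤP.<⇒≤ (σ>0 k)) (step-nonNeg r k)

  rayWeight : ℕ → ℕ
  rayWeight r = ∣ weight n (ray r) ∣

  weight-ray : ∀ r → weight n (ray r) ≡ + rayWeight r
  weight-ray r = sym (ℤP.0≤i⇒+∣i∣≡i (total-nonNeg n (λ i _ → ray-nonNeg r (suc i))))

  rayWeight>0 : ∀ r → r ℕ.< n → 0 ℕ.< rayWeight r
  rayWeight>0 r r<n = ℤP.drop‿+<+ (subst (0ℤ <_) (weight-ray r)
    (total-pos n (λ i _ → ray-nonNeg r (suc i)) r r<n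
      (subst (0ℤ <_) (sym (trans (cong (σ (suc r) *_) (step-suc r)) (ℤP.*-identityʳ (σ (suc r))))) (σ>0 (suc r)))))

  -- The generator `ray r` raises facet r by exactly one period and leaves the other facets fixed.
  upper-shift : ∀ a r m → ext (cardinality (kind a r) n) m ≡ ext (cardinality (upper a r) n) (m + + rayWeight r)
  upper-shift a r m = trans
    (cardinality-affine n 1ℤ (inj₁ refl) (ray r) (ℤP.*-zeroʳ (σ 0)) (kind a r) (upper a r) maps maps⁻¹ m)
    (cong (ext (cardinality (upper a r) n)) (cong₂ _+_ (ℤP.*-identityˡ m) (weight-ray r)))
    where
    maps : ∀ {i x} → i ℕ.< n → Holds (kind a r) i x → Holds (upper a r) i (1ℤ * x + facet (ray r) i)
    maps {i} {x} lt h@(a≤x , below) with i ℕ.≟ r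
    ... | no i≢r = subst (Holds (upper a r) i)
      (sym (trans (cong₂ _+_ (ℤP.*-identityˡ x) (facet-ray-≢ r i i≢r)) (ℤP.+-identityʳ x)))
      (h , λ e → contradiction e i≢r)
    ... | yes refl = subst (Holds (upper a r) r)
      (sym (cong₂ _+_ (ℤP.*-identityˡ x) (facet-ray-≡ r)))
      ((i≤j⇒i≤j+nonNeg a≤x (ℤP.<⇒≤ (Norm>0 r)) , λ r<r → contradiction r<r (ℕP.<-irrefl refl)) ,
       λ _ → ℤP.+-monoˡ-≤ (Norm r) a≤x)
    maps⁻¹ : ∀ {i x} → i ℕ.< n → Holds (upper a r) i x → Holds (kind a r) i (1ℤ * (x - facet (ray r) i))
    maps⁻¹ {i} {x} lt (h , above) with i ℕ.≟ r
    ... | no i≢r = subst (Holds (kind a r) i)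
      (sym (trans (ℤP.*-identityˡ _) (trans (cong (λ y → x - y) (facet-ray-≢ r i i≢r)) (ℤP.+-identityʳ x)))) h
    ... | yes refl = subst (Holds (kind a r) r)
      (sym (trans (ℤP.*-identityˡ _) (cong (λ y → x - y) (facet-ray-≡ r))))
      (i+k≤j⇒i≤j-k (+ a) (Norm r) x (above refl) , λ r<r → contradiction r<r (ℕP.<-irrefl refl))

  kind-split : ∀ a r → r ℕ.< n → ∀ m →
    cardinality (kind a r) n m ≡ cardinality (kind a (suc r)) n m + cardinality (upper a r) n m
  kind-split a r r<n = cardinality-split (kind a r) (kind a (suc r)) (upper a r) n cover incl₁ incl₂ disjoint
    where
    cover : ∀ f → Region (kind a r) n f → Region (kind a (suc r)) n f ⊎ Region (upper a r) n f
    cover f rf with facet f r ℤ.<? + a + Norm r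
    ... | yes below = inj₁ λ i lt → proj₁ (rf i lt) , λ i<1+r → [ proj₂ (rf i lt) , (λ { refl → below }) ]′ (ℕP.m≤n⇒m<n∨m≡n (ℕ.s≤s⁻¹ i<1+r))
    ... | no ¬below = inj₂ λ i lt → rf i lt , λ { refl → ℤP.≮⇒≥ ¬below }
    incl₁ : ∀ f → Region (kind a (suc r)) n f → Region (kind a r) n f
    incl₁ f rf i lt = proj₁ (rf i lt) , λ i<r → proj₂ (rf i lt) (ℕP.m<n⇒m<1+n i<r)
    incl₂ : ∀ f → Region (upper a r) n f → Region (kind a r) n f
    incl₂ f rf i lt = proj₁ (rf i lt)
    disjoint : ∀ f → Region (kind a (suc r)) n f → ¬ Region (upper a r) n f
    disjoint f r₁ r₂ = ℤP.<⇒≱ (proj₂ (r₁ r r<n) ℕP.≤-refl) (proj₂ (r₂ r r<n) refl)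

  -- Subtracting the translate by generator r removes what lies beyond one period of facet r. On
  -- counting series this is one factor 1 - q^|vᵣ| of D.
  kind-step : ∀ a r → r ℕ.< n → ∀ m →
    ext (cardinality (kind a r) n) m - ext (cardinality (kind a r) n) (m - 1ℤ * + rayWeight r)
    ≡ ext (cardinality (kind a (suc r)) n) m
  kind-step a r r<n m = trans
    (cong₂ _-_ (split m) (trans (upper-shift a r (m - 1ℤ * + rayWeight r)) (cong (ext (cardinality (upper a r) n)) (restore m (+ rayWeight r)))))
    (cancel (ext (cardinality (kind a (suc r)) n) m) (ext (cardinality (upper a r) n) m))
    where
    split : ∀ m → ext (cardinality (kind a r) n) m ≡ ext (cardinality (kind a (suc r)) n) m + ext (cardinality (upper a r) n) m
    split (+ m)    = kind-split a r r<n m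
    split -[1+ m ] = refl
    restore : ∀ m w → m - 1ℤ * w + w ≡ m
    restore = solve-∀
    cancel : ∀ x y → x + y - y ≡ x
    cancel = solve-∀

  weights : ℕ → List ℕ
  weights zero    = []
  weights (suc r) = rayWeight r ∷ weights r

  weights>0 : ∀ r → r ℕ.≤ n → All (0 ℕ.<_) (weights r)
  weights>0 zero    le = []
  weights>0 (suc r) le = rayWeight>0 r le ∷ weights>0 r (ℕP.<⇒≤ le)

  kind-prod : ∀ a r → r ℕ.≤ n → prodAct 1ℤ (weights r) (ext (cardinality (kind a 0) n)) ≗ ext (cardinality (kind a r) n)
  kind-prod a zero    le m = refl
  kind-prod a (suc r) le m = trans (cong₂ _-_ (kind-prod a r (ℕP.<⇒≤ le) m) (kind-prod a r (ℕP.<⇒≤ le) _)) (kind-step a r le m)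

  raySum : ℕ → ℕ → ℤ
  raySum zero    k = 0ℤ
  raySum (suc r) k = 1ℤ * ray r k + raySum r k

  raySum-0 : ∀ r → raySum r 0 ≡ 0ℤ
  raySum-0 zero    = refl
  raySum-0 (suc r) = cong₂ (λ x y → 1ℤ * x + y) (ℤP.*-zeroʳ (σ 0)) (raySum-0 r)

  weight-raySum : ∀ r → weight n (raySum r) ≡ + sum (weights r)
  weight-raySum zero    = total-zero n
  weight-raySum (suc r) = trans (total-linear n 1ℤ (ray r ∘ suc) (raySum r ∘ suc))
    (cong₂ _+_ (trans (ℤP.*-identityˡ _) (weight-ray r)) (weight-raySum r))

  facet-raySum-≥ : ∀ r i → r ℕ.≤ i → facet (raySum r) i ≡ 0ℤ
  facet-raySum-≥ zero    i le = refl
  facet-raySum-≥ (suc r) i le = trans (facet-linear 1ℤ (ray r) (raySum r) i)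
    (cong₂ (λ x y → 1ℤ * x + y) (facet-ray-≢ r i (λ { refl → ℕP.<-irrefl refl le })) (facet-raySum-≥ r i (ℕP.<⇒≤ le)))

  facet-raySum-< : ∀ r i → i ℕ.< r → facet (raySum r) i ≡ Norm i
  facet-raySum-< (suc r) i lt with i ℕ.≟ r
  ... | yes refl = trans (facet-linear 1ℤ (ray r) (raySum r) r)
    (trans (cong₂ (λ x y → 1ℤ * x + y) (facet-ray-≡ r) (facet-raySum-≥ r r ℕP.≤-refl)) (simplify (Norm r)))
    where
    simplify : ∀ x → 1ℤ * x + 0ℤ ≡ x
    simplify = solve-∀
  ... | no i≢r = trans (facet-linear 1ℤ (ray r) (raySum r) i)
    (trans (cong₂ (λ x y → 1ℤ * x + y) (facet-ray-≢ r i i≢r) (facet-raySum-< r i (ℕP.≤∧≢⇒< (ℕ.s≤s⁻¹ lt) i≢r))) (ℤP.+-identityˡ (Norm i)))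

  closed interior box : Series
  closed   = cardinality (kind 0 0) n
  interior = cardinality (kind 1 0) n
  box      = cardinality (kind 0 n) n

  M : ℤ
  M = + sum (weights n)

  -- On facet values the map is x ↦ Norm i - x, which exchanges 1 ≤ x ≤ Norm i with 0 ≤ x < Norm i;
  -- the choice of half-open ends makes closed cone and interior trade places.
  reflection : ∀ m → ext (cardinality (kind 1 n) n) m ≡ ext box (- (m - M))
  reflection m = trans
    (cardinality-affine n -1ℤ (inj₂ refl) (raySum n) (raySum-0 n) (kind 1 n) (kind 0 n) maps maps⁻¹ m)
    (cong (ext box) (trans (cong (_+_ (-1ℤ * m)) (weight-raySum n)) (index m M)))
    where
    index : ∀ m w → -1ℤ * m + w ≡ - (m - w)
    index = solve-∀
    maps : ∀ {i x} → i ℕ.< n → Holds (kind 1 n) i x → Holds (kind 0 n) i (-1ℤ * x + facet (raySum n) i)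
    maps {i} {x} lt (1≤x , below) = subst (Holds (kind 0 n) i) (sym (trans (cong (_+_ (-1ℤ * x)) (facet-raySum-< n i lt)) (swap x (Norm i))))
      (ℤP.i≤j⇒0≤j-i (subst (x ≤_) (ℤP.pred-suc (Norm i)) (ℤP.i<j⇒i≤pred[j] (below lt))) ,
       λ _ → subst (Norm i - x <_) (ℤP.+-comm (Norm i) 0ℤ) (ℤP.+-monoʳ-< (Norm i) (ℤP.neg-mono-< (ℤP.<-≤-trans (ℤ.+<+ ℕP.≤-refl) 1≤x))))
      where
      swap : ∀ x y → -1ℤ * x + y ≡ y - x
      swap = solve-∀
    maps⁻¹ : ∀ {i x} → i ℕ.< n → Holds (kind 0 n) i x → Holds (kind 1 n) i (-1ℤ * (x - facet (raySum n) i))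
    maps⁻¹ {i} {x} lt (0≤x , below) = subst (Holds (kind 1 n) i) (sym (trans (cong (λ y → -1ℤ * (x - y)) (facet-raySum-< n i lt)) (swap x (Norm i))))
      (i+k≤j⇒i≤j-k 1ℤ x (Norm i) (ℤP.i<j⇒suc[i]≤j (subst (x <_) (ℤP.+-identityˡ (Norm i)) (below lt))) ,
       λ _ → ℤP.≤-<-trans (ℤP.+-monoʳ-≤ (Norm i) (ℤP.neg-mono-≤ 0≤x)) (subst (Norm i + 0ℤ <_) (ℤP.+-comm (Norm i) 1ℤ) (ℤP.+-monoʳ-< (Norm i) (ℤ.+<+ ℕP.≤-refl))))
      where
      swap : ∀ x y → -1ℤ * (x - y) ≡ y - x
      swap = solve-∀

  numerator : Poly
  numerator = applyUpTo box (suc (sum (weights n)))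

  coeff-numerator : coeff numerator ≈S box
  coeff-numerator m = coeff-applyUpTo box (suc (sum (weights n))) m vanishes
    where
    -- Beyond degree M the reflected degree is negative, where there are no points.
    vanishes : sum (weights n) ℕ.< m → box m ≡ 0ℤ
    vanishes lt = trans (cong (ext box) (index (+ m) M)) (trans (sym (reflection (M - + m)))
      (ext-below (cardinality (kind 1 n) n) (M - + m) (subst (M - + m <_) (ℤP.+-inverseʳ (+ m)) (ℤP.+-monoˡ-< (- (+ m)) (ℤ.+<+ lt)))))
      where
      index : ∀ m w → m ≡ - (w - m - w)
      index = solve-∀

  numerator-δ : act 1ℤ numerator δ ≗ ext box
  numerator-δ m = trans (act-δ numerator m) (ext-cong coeff-numerator m)

  rational : act 1ℤ (prodOneMinus (weights n)) (ext closed) ≗ act 1ℤ numerator δ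
  rational m = trans (act-prodOneMinus 1ℤ (weights n) (ext closed) m)
    (trans (kind-prod 0 n ℕP.≤-refl m) (sym (numerator-δ m)))

  rational° : ∀ m → act 1ℤ (prodOneMinus (weights n)) (ext interior) m ≡ act -1ℤ numerator δ (m - M)
  rational° m = trans (act-prodOneMinus 1ℤ (weights n) (ext interior) m)
    (trans (kind-prod 1 n ℕP.≤-refl m) (trans (reflection m)
      (trans (sym (numerator-δ (- (m - M)))) (sym (act-reflect-δ -1ℤ numerator (m - M))))))

  origin : ℕ → ℤ
  origin _ = 0ℤ

  origin∈ : ∀ r → tab n origin ∈ points (inRegion (kind 0 r) n) n 0
  origin∈ r = ∈-region⁺ (kind 0 r) n origin refl
    (λ i lt → ℤP.≤-refl , λ _ → subst (0ℤ <_) (sym (ℤP.+-identityˡ (Norm i))) (Norm>0 i)) (weight-raySum 0)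

  inhabited⇒length>0 : ∀ {A : Set} {x : A} {xs} → x ∈ xs → 0 ℕ.< length xs
  inhabited⇒length>0 {xs = _ ∷ _} _ = ℕ.s≤s ℕ.z≤n

  cardinality-0 : ∀ r → 0ℤ < cardinality (kind 0 r) n 0
  cardinality-0 r = ℤ.+<+ (inhabited⇒length>0 (origin∈ r))

  numerator-nonZero : NonZeroPoly numerator
  numerator-nonZero = 0 , λ e → ℤP.<⇒≢ (cardinality-0 n) (sym e)

  -- Translation by c raises every facet value by exactly 1, so it maps the cone onto its interior
  -- and not merely into it.
  unimodularInteriorPoint⇒selfReciprocal : ∀ c → c 0 ≡ 0ℤ → (∀ i → i ℕ.< n → facet c i ≡ 1ℤ) → SelfReciprocal closed
  unimodularInteriorPoint⇒selfReciprocal c c0 unit = numeratorSymmetry⇒selfReciprocal (weights n) (weights>0 n ℕP.≤-refl) closed numerator rational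
    k numerator-nonZero symmetry
    where
    k : ℕ
    k = ∣ weight n c ∣
    weight-c : weight n c ≡ + k
    weight-c = sym (ℤP.0≤i⇒+∣i∣≡i (total-nonNeg n (λ i lt → facets-nonNeg⇒nonNeg n c c0 (λ i lt → subst (0ℤ ≤_) (sym (unit i lt)) (ℤ.+≤+ ℕ.z≤n)) (suc i) lt)))
    shift : ∀ m → ext closed m ≡ ext interior (1ℤ * m + weight n c)
    shift = cardinality-affine n 1ℤ (inj₁ refl) c c0 (kind 0 0) (kind 1 0)
      (λ {i} {x} lt (0≤x , _) → subst (1ℤ ≤_) (sym (cong₂ _+_ (ℤP.*-identityˡ x) (unit i lt))) (ℤP.+-monoˡ-≤ 1ℤ 0≤x) , λ ())
      (λ {i} {x} lt (1≤x , _) → subst (0ℤ ≤_) (sym (trans (ℤP.*-identityˡ _) (cong (λ y → x - y) (unit i lt)))) (ℤP.i≤j⇒0≤j-i 1≤x) , λ ())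
    unshift : ∀ m → ext interior m ≡ ext closed (m - + k)
    unshift m = sym (trans (shift (m - + k)) (cong (ext interior) (trans (cong (_+_ (1ℤ * (m - + k))) weight-c) (index m (+ k)))))
      where
      index : ∀ m k → 1ℤ * (m - k) + k ≡ m
      index = solve-∀
    symmetry : ∀ m → act -1ℤ numerator δ (m - M) ≡ act 1ℤ numerator δ (m - + k)
    symmetry m = begin
      act -1ℤ numerator δ (m - M)            ≡⟨ sym (rational° m) ⟩
      act 1ℤ D (ext interior) m              ≡⟨ act-cong 1ℤ D unshift m ⟩
      act 1ℤ D (λ i → ext closed (i - + k)) m ≡⟨ act-shift 1ℤ D (ext closed) (+ k) m ⟩
      act 1ℤ D (ext closed) (m - + k)        ≡⟨ rational (m - + k) ⟩
      act 1ℤ numerator δ (m - + k)           ∎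
      where
      open ≡-Reasoning
      D = prodOneMinus (weights n)

  private
    module Minimal (k : ℕ) (ε : ℤ) (ε-sign : IsSign ε) (symmetry : ∀ m → ext interior m ≡ ε * ext closed (m - + k)) where

      interior-shift : ∀ m → interior (m ℕ.+ k) ≡ ε * closed m
      interior-shift m = trans (symmetry (+ (m ℕ.+ k))) (cong (λ i → ε * ext closed i) (index (+ m) (+ k)))
        where
        index : ∀ m k → m + k - k ≡ m
        index = solve-∀

      -- A minus sign would make the number of interior points of degree k negative, since degree 0
      -- of the cone contains the origin.
      ε≢-1 : ε ≢ -1ℤ
      ε≢-1 e = ℤP.<⇒≱ (ℤP.neg-mono-< (cardinality-0 0))
        (subst (0ℤ ≤_) (trans (interior-shift 0) (trans (cong (_* closed 0) e) (ℤP.-1*i≡-i (closed 0)))) (ℤ.+≤+ ℕ.z≤n))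

      ε≡1 : ε ≡ 1ℤ
      ε≡1 = [ id , (λ e → contradiction e ε≢-1) ]′ ε-sign

      equinumerous : ∀ m → interior (m ℕ.+ k) ≡ closed m
      equinumerous m = trans (interior-shift m) (trans (cong (_* closed m) ε≡1) (ℤP.*-identityˡ (closed m)))

      pick : ∃[ xs ] xs ∈ points (inRegion (kind 1 0) n) n k
      pick = nonempty (points (inRegion (kind 1 0) n) n k)
        (ℤP.drop‿+<+ (subst (0ℤ <_) (sym (equinumerous 0)) (cardinality-0 0)))
        where
        nonempty : ∀ {A : Set} (xs : List A) → 0 ℕ.< length xs → ∃[ x ] x ∈ xs
        nonempty (x ∷ xs) _ = x , here refl

    module Shift (c : ℕ → ℤ) (c0 : c 0 ≡ 0ℤ) (c-region : Region (kind 1 0) n c) where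

      shifted : (ℕ → ℤ) → ℕ → ℤ
      shifted = affine n 1ℤ (inj₁ refl) c c0

      maps : ∀ {i x} → i ℕ.< n → Holds (kind 0 0) i x → Holds (kind 1 0) i (1ℤ * x + facet c i)
      maps {i} {x} lt (0≤x , _) = subst (1ℤ ≤_) (trans (ℤP.+-comm (facet c i) x) (cong (_+ facet c i) (sym (ℤP.*-identityˡ x))))
        (i≤j⇒i≤j+nonNeg (proj₁ (c-region i lt)) 0≤x) , λ ()

      shifted-tab : ∀ {xs} → Region (kind 0 0) n (pt xs) → ∀ i → i ℕ.≤ n → pt (tab n (shifted (pt xs))) i ≡ shifted (pt xs) i
      shifted-tab {xs} rx = pt-tab n {shifted (pt xs)} shifted-0
        (region-nonNeg (kind 1 0) n (shifted (pt xs)) shifted-0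
          (affine-region n 1ℤ (inj₁ refl) c c0 (kind 0 0) (kind 1 0) maps (pt xs) rx))
        where
        shifted-0 : shifted (pt xs) 0 ≡ 0ℤ
        shifted-0 = affine-0 n 1ℤ (inj₁ refl) c c0 xs

      missed : ∀ f → f 0 ≡ 0ℤ → Region (kind 1 0) n f → ¬ Region (kind 0 0) n (λ j → -1ℤ * c j + f j) →
        ∀ m {xs} → xs ∈ points (inRegion (kind 0 0) n) n m → tab n (shifted (pt xs)) ≢ tab n f
      missed f f0 f-region ¬r m {xs} xs∈ e = ¬r (region-cong (kind 0 0) n (pt xs) (λ j → -1ℤ * c j + f j) agree rx)
        where
        rx : Region (kind 0 0) n (pt xs)
        rx = proj₁ (proj₂ (∈-region⁻ (kind 0 0) n {m = m} xs∈))
        solve-for : ∀ x y z → 1ℤ * x + y ≡ z → x ≡ -1ℤ * y + z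
        solve-for x y z refl = lemma x y
          where
          lemma : ∀ x y → x ≡ -1ℤ * y + (1ℤ * x + y)
          lemma = solve-∀
        agree : ∀ i → i ℕ.≤ n → pt xs i ≡ -1ℤ * c i + f i
        agree i le = solve-for (pt xs i) (c i) (f i) (trans (sym (shifted-tab rx i le))
          (trans (cong (λ zs → pt zs i) e) (pt-tab n {f} f0 (region-nonNeg (kind 1 0) n f f0 f-region) i le)))

      -- If f - c lies outside the cone, then f is missed by the translation by c, which therefore
      -- injects degree m into degree w without being onto.
      grows : ∀ m w → + m + weight n c ≡ + w → ∀ f → f 0 ≡ 0ℤ → Region (kind 1 0) n f → weight n f ≡ + w →
        ¬ Region (kind 0 0) n (λ j → -1ℤ * c j + f j) → closed m < interior w
      grows m w e f f0 f-region wf ¬r = ℤ.+<+ (injection-length-< (λ xs → tab n (shifted (pt xs)))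
        (points-unique (inRegion (kind 0 0) n) n m)
        (affine-∈ n 1ℤ (inj₁ refl) c c0 (kind 0 0) (kind 1 0) maps {m} {w} (trans (cong (_+ weight n c) (ℤP.*-identityˡ (+ m))) e))
        (affine-tab-injective n 1ℤ (inj₁ refl) c c0 (kind 0 0) (kind 1 0) maps {m})
        (∈-region⁺ (kind 1 0) n f f0 f-region wf) (missed f f0 f-region ¬r m))

  -- An interior f with f - c outside the cone would break the equality of counts between degrees w
  -- - k and w, where w is the weight of f; if w < k, the symmetry leaves no interior point in
  -- degree w at all.
  minimalInteriorPoint : ∀ k ε → IsSign ε → (∀ m → ext interior m ≡ ε * ext closed (m - + k)) →
    ∃[ c ] c 0 ≡ 0ℤ × (∀ i → i ℕ.< n → 1ℤ ≤ facet c i) ×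
      (∀ f → f 0 ≡ 0ℤ → (∀ i → i ℕ.< n → 1ℤ ≤ facet f i) → ∀ i → i ℕ.< n → facet c i ≤ facet f i)
  minimalInteriorPoint k ε ε-sign symmetry = c , refl , (λ i lt → proj₁ (c-region i lt)) ,
    λ f f0 f-interior → minimal f f0 (λ i lt → f-interior i lt , λ ())
    where
    open Minimal k ε ε-sign symmetry
    c : ℕ → ℤ
    c = pt (proj₁ pick)
    c∈ = ∈-region⁻ (kind 1 0) n {m = k} (proj₂ pick)
    c-region : Region (kind 1 0) n c
    c-region = proj₁ (proj₂ c∈)
    c-weight : weight n c ≡ + k
    c-weight = proj₂ (proj₂ c∈)
    open Shift c refl c-region
    contra : ∀ f → f 0 ≡ 0ℤ → Region (kind 1 0) n f → ¬ Region (kind 0 0) n (λ j → -1ℤ * c j + f j) →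
      ∀ w → weight n f ≡ + w → ∀ d → + w - + k ≡ d → ⊥
    contra f f0 f-region ¬r w e (+ m) eq = ℤP.<-irrefl (sym (trans (cong interior w≡) (equinumerous m)))
      (grows m w (trans (cong (_+_ (+ m)) c-weight) (sym (cong +_ w≡))) f f0 f-region e ¬r)
      where
      w≡ : w ≡ m ℕ.+ k
      w≡ = ℤP.+-injective (trans (index (+ w) (+ k)) (cong (_+ + k) eq))
        where
        index : ∀ w k → w ≡ w - k + k
        index = solve-∀
    contra f f0 f-region ¬r w e -[1+ m ] eq = ℤP.<-irrefl refl (subst (0ℤ <_)
      (trans (symmetry (+ w)) (trans (cong (λ i → ε * ext closed i) eq) (ℤP.*-zeroʳ ε)))
      (ℤ.+<+ (inhabited⇒length>0 (∈-region⁺ (kind 1 0) n f f0 f-region e))))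
    minimal : ∀ f → f 0 ≡ 0ℤ → Region (kind 1 0) n f → ∀ i → i ℕ.< n → facet c i ≤ facet f i
    minimal f f0 f-region = conclude (region? (kind 0 0) n (λ j → -1ℤ * c j + f j))
      where
      swap : ∀ x y → -1ℤ * x + y ≡ y - x
      swap = solve-∀
      conclude : Dec (Region (kind 0 0) n (λ j → -1ℤ * c j + f j)) → ∀ i → i ℕ.< n → facet c i ≤ facet f i
      conclude (yes r) i lt = ℤP.0≤i-j⇒j≤i (subst (0ℤ ≤_) (trans (facet-linear -1ℤ c f i) (swap (facet c i) (facet f i))) (proj₁ (r i lt)))
      conclude (no ¬r) = ⊥-elim (contra f f0 f-region ¬r (∣ weight n f ∣)
        (sym (ℤP.0≤i⇒+∣i∣≡i (total-nonNeg n (λ i lt → region-nonNeg (kind 1 0) n f f0 f-region (suc i) lt)))) _ refl)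

  selfReciprocal⇒minimalInteriorPoint : SelfReciprocal closed →
    ∃[ c ] c 0 ≡ 0ℤ × (∀ i → i ℕ.< n → 1ℤ ≤ facet c i) ×
      (∀ f → f 0 ≡ 0ℤ → (∀ i → i ℕ.< n → 1ℤ ≤ facet f i) → ∀ i → i ℕ.< n → facet c i ≤ facet f i)
  selfReciprocal⇒minimalInteriorPoint sr =
    let k , ε , ε-sign , symmetry = selfReciprocal⇒symmetry (weights n) (weights>0 n ℕP.≤-refl) closed numerator rational interior rational° sr
    in minimalInteriorPoint k ε ε-sign symmetry

-- The sequence s and the facet values of the minimal interior point

difference⇒≤ : ∀ {x y} d → 0ℤ ≤ d → d ≡ y - x → x ≤ y
difference⇒≤ d 0≤d e = ℤP.0≤i-j⇒j≤i (subst (0ℤ ≤_) e 0≤d)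

*-mono-≤-nonNeg : ∀ {x y u v} → 0ℤ ≤ x → 0ℤ ≤ v → x ≤ y → u ≤ v → x * u ≤ y * v
*-mono-≤-nonNeg {x} {y} {u} {v} 0≤x 0≤v x≤y u≤v = ℤP.≤-trans
  (ℤP.*-monoˡ-≤-nonNeg x {{ℤ.nonNegative 0≤x}} u≤v) (ℤP.*-monoʳ-≤-nonNeg v {{ℤ.nonNegative 0≤v}} x≤y)

0<+suc : ∀ n → 0ℤ < + suc n
0<+suc n = ℤ.+<+ (ℕ.s≤s ℕ.z≤n)

module Sequence (ℓ b : ℤ) (0<ℓ : 0ℤ < ℓ) (discriminant : 0ℤ ≤ ℓ * ℓ + + 4 * b) where

  s : ℕ → ℤ
  s = seq ℓ b

  -- Twice the gap in the conclusion is ℓ times the gap in the assumption plus (k + 1) x times the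
  -- discriminant.
  ratio-step : ∀ k → 0ℤ ≤ + 1 + k → ∀ x y → 0ℤ ≤ x → (+ 1 + k) * (ℓ * x) ≤ + 2 * (k * y) →
    (+ 2 + k) * (ℓ * y) ≤ + 2 * ((+ 1 + k) * (ℓ * y + b * x))
  ratio-step k 0≤k x y 0≤x le = ℤP.*-cancelˡ-≤-pos _ _ (+ 2)
    (difference⇒≤ _ (ℤP.+-mono-≤ (*-nonNeg (ℤP.<⇒≤ 0<ℓ) (ℤP.i≤j⇒0≤j-i le)) (*-nonNeg 0≤k (*-nonNeg discriminant 0≤x))) (identity ℓ b k x y))
    where
    identity : ∀ ℓ b k x y → ℓ * (+ 2 * (k * y) - (+ 1 + k) * (ℓ * x)) + (+ 1 + k) * ((ℓ * ℓ + + 4 * b) * x)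
      ≡ + 2 * (+ 2 * ((+ 1 + k) * (ℓ * y + b * x))) - + 2 * ((+ 2 + k) * (ℓ * y))
    identity = solve-∀

  -- The ratio bound is an equality when x² − ℓ x − b has a double root, sₖ = k (ℓ / 2)^(k − 1).
  positive×ratio : ∀ n → 0ℤ < s (suc n) × + (2 ℕ.+ n) * (ℓ * s (suc n)) ≤ + 2 * (+ suc n * s (2 ℕ.+ n))
  positive×ratio zero = ℤ.+<+ (ℕ.s≤s ℕ.z≤n) , ℤP.≤-reflexive (base ℓ b)
    where
    base : ∀ ℓ b → + 2 * (ℓ * 1ℤ) ≡ + 2 * (1ℤ * (ℓ * 1ℤ + b * 0ℤ))
    base = solve-∀
  positive×ratio (suc n) = next , ratio-step (+ suc n) (ℤ.+≤+ ℕ.z≤n) (s (suc n)) (s (2 ℕ.+ n)) (ℤP.<⇒≤ here>0) ratio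
    where
    here>0 : 0ℤ < s (suc n)
    here>0 = proj₁ (positive×ratio n)
    ratio : + (2 ℕ.+ n) * (ℓ * s (suc n)) ≤ + 2 * (+ suc n * s (2 ℕ.+ n))
    ratio = proj₂ (positive×ratio n)
    next : 0ℤ < s (2 ℕ.+ n)
    next = ℤP.*-cancelˡ-<-nonNeg {i = 0ℤ} {s (2 ℕ.+ n)} (+ suc n) (subst (_< + suc n * s (2 ℕ.+ n)) (sym (ℤP.*-zeroʳ (+ suc n)))
      (ℤP.*-cancelˡ-<-nonNeg {i = 0ℤ} {+ suc n * s (2 ℕ.+ n)} (+ 2) (ℤP.<-≤-trans (*-pos (0<+suc (suc n)) (*-pos 0<ℓ here>0)) ratio)))

  positive : ∀ n → 0ℤ < s (suc n)
  positive n = proj₁ (positive×ratio n)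

  -- The quadratic form y² - ℓ y x - b x² is multiplied by -b when (x, y) becomes (y, ℓ y + b x). As
  -- a form in two consecutive terms it lets their common divisor be pulled out squared.
  determinant : ∀ n → s (suc n) * s (suc n) - ℓ * (s (suc n) * s n) - b * (s n * s n) ≡ (- b) ℤ.^ n
  determinant zero    = base ℓ b
    where
    base : ∀ ℓ b → 1ℤ * 1ℤ - ℓ * (1ℤ * 0ℤ) - b * (0ℤ * 0ℤ) ≡ 1ℤ
    base = solve-∀
  determinant (suc n) = trans (identity ℓ b (s (suc n)) (s n)) (cong (- b *_) (determinant n))
    where
    identity : ∀ ℓ b y x → (ℓ * y + b * x) * (ℓ * y + b * x) - ℓ * ((ℓ * y + b * x) * y) - b * (y * y)
      ≡ - b * (y * y - ℓ * (y * x) - b * (x * x))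
    identity = solve-∀

  -- Agrees with `s` except at 0, where s₀ = 0 would annihilate facet 0.
  σ : ℕ → ℤ
  σ zero    = 1ℤ
  σ (suc i) = s (suc i)

  σ>0 : ∀ i → 0ℤ < σ i
  σ>0 zero    = ℤ.+<+ (ℕ.s≤s ℕ.z≤n)
  σ>0 (suc i) = positive i

  chain⇒ : ∀ i xs → T (lhChain s i xs) → ∀ k → suc k ℕ.< length xs → + entry xs k * s (suc (k ℕ.+ i)) ≤ + entry xs (suc k) * s (k ℕ.+ i)
  chain⇒ i (x ∷ [])       t k       (ℕ.s≤s ())
  chain⇒ i (x ∷ y ∷ rest) t zero    lt         = ℤP.≤ᵇ⇒≤ (proj₁ (Equivalence.to T-∧ t))
  chain⇒ i (x ∷ y ∷ rest) t (suc k) (ℕ.s≤s lt) = subst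
    (λ j → + entry (y ∷ rest) k * s (suc j) ≤ + entry (y ∷ rest) (suc k) * s j) (ℕP.+-suc k i)
    (chain⇒ (suc i) (y ∷ rest) (proj₂ (Equivalence.to (T-∧ {+ x * s (suc i) ℤ.≤ᵇ + y * s i}) t)) k lt)

  chain⇐ : ∀ i xs → (∀ k → suc k ℕ.< length xs → + entry xs k * s (suc (k ℕ.+ i)) ≤ + entry xs (suc k) * s (k ℕ.+ i)) → T (lhChain s i xs)
  chain⇐ i []             le = _
  chain⇐ i (x ∷ [])       le = _
  chain⇐ i (x ∷ y ∷ rest) le = Equivalence.from T-∧ (ℤP.≤⇒≤ᵇ (le 0 (ℕ.s≤s (ℕ.s≤s ℕ.z≤n))) ,
    chain⇐ (suc i) (y ∷ rest) (λ k lt → subst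
      (λ j → + entry (y ∷ rest) k * s (suc j) ≤ + entry (y ∷ rest) (suc k) * s j) (sym (ℕP.+-suc k i)) (le (suc k) (ℕ.s≤s lt))))

  module _ (n : ℕ) where

    open Cone σ σ>0 using (facet; Region; region?; inRegion)
    open Reciprocity σ σ>0 n using (kind; closed)

    lhGF≈closed : lhGF s n ≈S closed
    lhGF≈closed m = cong +_ (ℕP.≤-antisym
      (number-mono (isLectureHall s) (inRegion (kind 0 0) n) n m
        (λ {xs} len t → fromWitness {a? = region? (kind 0 0) n (pt xs)} (to xs len t)))
      (number-mono (inRegion (kind 0 0) n) (isLectureHall s) n m
        (λ {xs} len t → from xs len (toWitness {a? = region? (kind 0 0) n (pt xs)} t))))
      where
      at-1 : ∀ xs k → ℤ → ℤ → Set
      at-1 xs k u v = + entry xs k * u ≤ + entry xs (suc k) * v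
      to : ∀ xs → length xs ≡ n → T (isLectureHall s xs) → Region (kind 0 0) n (pt xs)
      -- Facet 0 is the entry λ₁ itself, nonnegative because tuples consist of naturals.
      to xs len t zero    lt = subst (0ℤ ≤_) (sym (simplify (+ entry xs 0) (s 1))) (ℤ.+≤+ ℕ.z≤n) , λ ()
        where
        simplify : ∀ x y → x * 1ℤ - 0ℤ * y ≡ x
        simplify = solve-∀
      to xs len t (suc k) lt = ℤP.i≤j⇒0≤j-i (subst (λ j → at-1 xs k (s (suc j)) (s j)) (ℕP.+-comm k 1)
        (chain⇒ 1 xs t k (subst (suc k ℕ.<_) (sym len) lt))) , λ ()
      from : ∀ xs → length xs ≡ n → Region (kind 0 0) n (pt xs) → T (isLectureHall s xs)
      from xs len r = chain⇐ 1 xs (λ k lt → subst (λ j → at-1 xs k (s (suc j)) (s j)) (sym (ℕP.+-comm k 1))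
        (ℤP.0≤i-j⇒j≤i (proj₁ (r (suc k) (subst (suc k ℕ.<_) len lt)))))

  b≡-1⇒selfReciprocal : b ≡ -1ℤ → ∀ n → SelfReciprocal (lhGF s n)
  b≡-1⇒selfReciprocal b≡-1 n = selfReciprocal-resp-≈S (λ m → sym (lhGF≈closed n m))
    (unimodularInteriorPoint⇒selfReciprocal c refl unit)
    where
    open Cone σ σ>0 using (facet)
    open Reciprocity σ σ>0 n using (unimodularInteriorPoint⇒selfReciprocal)
    c : ℕ → ℤ
    c zero    = 0ℤ
    c (suc i) = s (suc i) + s i
    unit : ∀ i → i ℕ.< n → facet c i ≡ 1ℤ
    unit zero    _ = base (s 1)
      where
      base : ∀ y → (1ℤ + 0ℤ) * 1ℤ - 0ℤ * y ≡ 1ℤ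
      base = solve-∀
    unit (suc i) _ = trans (identity ℓ b (s (suc i)) (s i)) (trans (determinant i)
      (trans (cong (λ x → (- x) ℤ.^ i) b≡-1) (ℤP.^-zeroˡ i)))
      where
      identity : ∀ ℓ b y x → ((ℓ * y + b * x) + y) * y - (y + x) * (ℓ * y + b * x) ≡ y * y - ℓ * (y * x) - b * (x * x)
      identity = solve-∀

-- Minimal facet values divide all facet values

module FacetDivisibility (σ : ℕ → ℤ) (σ>0 : ∀ i → 0ℤ < σ i) (n : ℕ) (c : ℕ → ℤ) where

  open Cone σ σ>0 using (facet; Norm; Norm>0; facet-linear; facet-scaled)

  module _ (c0 : c 0 ≡ 0ℤ)
    (minimal : ∀ f → f 0 ≡ 0ℤ → (∀ i → i ℕ.< n → 1ℤ ≤ facet f i) → ∀ i → i ℕ.< n → facet c i ≤ facet f i)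
    (j : ℕ) (j<n : j ℕ.< n) where

    -- Adding multiples of the other ray generators makes f interior without
    -- changing its j-th facet value.
    facet-minimal : ∀ f → f 0 ≡ 0ℤ → 0ℤ < facet f j → facet c j ≤ facet f j
    facet-minimal f f0 pos = subst (facet c j ≤_) (trans (value j) (at-j refl)) (minimal f⁺ f⁺0 (λ i _ → interior i) j j<n)
      where
      boost : ∀ i → Dec (i ≡ j) → ℤ
      boost i (yes _) = 0ℤ
      boost i (no  _) = + suc ∣ facet f i ∣
      κ : ℕ → ℤ
      κ zero    = 0ℤ
      κ (suc i) = κ i + boost i (i ℕ.≟ j)
      f⁺ : ℕ → ℤ
      f⁺ k = 1ℤ * f k + σ k * κ k
      f⁺0 : f⁺ 0 ≡ 0ℤ
      f⁺0 = cong₂ (λ x y → 1ℤ * x + y) f0 (ℤP.*-zeroʳ (σ 0))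
      value : ∀ i → facet f⁺ i ≡ facet f i + Norm i * boost i (i ℕ.≟ j)
      value i = trans (facet-linear 1ℤ f (λ k → σ k * κ k) i)
        (cong₂ _+_ (ℤP.*-identityˡ (facet f i)) (trans (facet-scaled κ i) (cong (Norm i *_) (cancel (κ i) (boost i (i ℕ.≟ j))))))
        where
        cancel : ∀ x y → x + y - x ≡ y
        cancel = solve-∀
      at-j : ∀ {i} → i ≡ j → facet f i + Norm i * boost i (i ℕ.≟ j) ≡ facet f i
      at-j {i} e = helper (i ℕ.≟ j)
        where
        helper : ∀ d → facet f i + Norm i * boost i d ≡ facet f i
        helper (yes _)  = trans (cong (_+_ (facet f i)) (ℤP.*-zeroʳ (Norm i))) (ℤP.+-identityʳ _)
        helper (no i≢j) = contradiction e i≢j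
      -∣x∣≤x : ∀ x → - + ∣ x ∣ ≤ x
      -∣x∣≤x (+ m)    = ℤP.neg-≤-pos
      -∣x∣≤x -[1+ m ] = ℤP.≤-refl
      -- As N ≥ 1, the summand N (1 + |x|) is at least 1 - x.
      bound : ∀ x N → 0ℤ < N → 1ℤ ≤ x + N * + suc ∣ x ∣
      bound x N 0<N = difference⇒≤ _ (ℤP.+-mono-≤ (*-nonNeg (ℤP.i≤j⇒0≤j-i (ℤP.i<j⇒suc[i]≤j 0<N)) (ℤ.+≤+ (ℕ.z≤n {suc ∣ x ∣})))
        (ℤP.i≤j⇒0≤j-i (-∣x∣≤x x))) (identity x N (+ ∣ x ∣))
        where
        identity : ∀ x N a → (N - 1ℤ) * (1ℤ + a) + (x - - a) ≡ x + N * (1ℤ + a) - 1ℤ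
        identity = solve-∀
      interior : ∀ i → 1ℤ ≤ facet f⁺ i
      interior i = subst (1ℤ ≤_) (sym (value i)) (helper (i ℕ.≟ j))
        where
        helper : ∀ d → 1ℤ ≤ facet f i + Norm i * boost i d
        helper (yes refl) = subst (1ℤ ≤_) (sym (trans (cong (_+_ (facet f j)) (ℤP.*-zeroʳ (Norm j))) (ℤP.+-identityʳ _))) (ℤP.i<j⇒suc[i]≤j pos)
        helper (no _)     = bound (facet f i) (Norm i) (Norm>0 i)

    -- Subtracting q times c leaves an integer point whose facet value is the remainder; a positive
    -- remainder would undercut the least positive value `facet c j`.
    facet-multiple : 0ℤ < facet c j → ∀ f → f 0 ≡ 0ℤ → ∃[ q ] facet f j ≡ q * facet c j
    facet-multiple pos f f0 = q , trans division (trans (cong (_+ q * g) (remainder r refl)) (ℤP.+-identityˡ (q * g)))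
      where
      g : ℤ
      g = facet c j
      instance
        g-nonZero : ℤ.NonZero g
        g-nonZero = ℤ.≢-nonZero (λ e → ℤP.<⇒≢ pos (sym e))
      q : ℤ
      q = facet f j DivMod./ g
      r : ℕ
      r = facet f j DivMod.% g
      division : facet f j ≡ + r + q * g
      division = DivMod.a≡a%n+[a/n]*n (facet f j) g
      residue : facet (λ k → - q * c k + f k) j ≡ + r
      residue = trans (facet-linear (- q) c f j) (trans (cong (_+_ (- q * g)) division) (cancel q g (+ r)))
        where
        cancel : ∀ q g r → - q * g + (r + q * g) ≡ r
        cancel = solve-∀
      r<g : + r < g
      r<g = subst (+ r <_) (ℤP.0≤i⇒+∣i∣≡i (ℤP.<⇒≤ pos)) (ℤ.+<+ (DivMod.n%d<d (facet f j) g))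
      remainder : ∀ r′ → r ≡ r′ → + r ≡ 0ℤ
      remainder zero     e = cong +_ e
      remainder (suc r′) e = contradiction r<g (ℤP.≤⇒≯ (subst (g ≤_) residue
        (facet-minimal (λ k → - q * c k + f k) (cong₂ _+_ (trans (cong (- q *_) c0) (ℤP.*-zeroʳ (- q))) f0)
          (subst (0ℤ <_) (sym (trans residue (cong +_ e))) (0<+suc r′)))))

∣^∣ : ∀ x k → ∣ x ℤ.^ k ∣ ≡ ∣ x ∣ ℕ.^ k
∣^∣ x zero    = refl
∣^∣ x (suc k) = trans (ℤP.abs-* x (x ℤ.^ k)) (cong (∣ x ∣ ℕ.*_) (∣^∣ x k))

pos-^ : ∀ m k → + (m ℕ.^ k) ≡ (+ m) ℤ.^ k
pos-^ m zero    = refl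
pos-^ m (suc k) = trans (ℤP.pos-* m (m ℕ.^ k)) (cong (+ m *_) (pos-^ m k))

^-pos : ∀ m k → 0 ℕ.< m → 0 ℕ.< m ℕ.^ k
^-pos m k 0<m = ℕP.m^n>0 m {{ℕ.>-nonZero 0<m}} k

double : ℕ → ℕ
double zero    = zero
double (suc p) = suc (suc (double p))

^-double : ∀ m p → m ℕ.^ double p ≡ m ℕ.^ p ℕ.* m ℕ.^ p
^-double m zero    = refl
^-double m (suc p) = trans (cong (λ x → m ℕ.* (m ℕ.* x)) (^-double m p)) (regroup m (m ℕ.^ p))
  where
  regroup : ∀ m x → m ℕ.* (m ℕ.* (x ℕ.* x)) ≡ m ℕ.* x ℕ.* (m ℕ.* x)
  regroup = ℕSolver.solve-∀

-- The contradiction for b other than -1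

module NotSelfReciprocal (ℓ b : ℤ) (0<ℓ : 0ℤ < ℓ) (discriminant : 0ℤ ≤ ℓ * ℓ + + 4 * b) where

  open Sequence ℓ b 0<ℓ discriminant
  open Cone σ σ>0 using (facet)

  B : ℕ
  B = ∣ b ∣

  S : ℕ → ℕ
  S i = ∣ s (suc i) ∣

  +S : ∀ i → + S i ≡ s (suc i)
  +S i = ℤP.0≤i⇒+∣i∣≡i (ℤP.<⇒≤ (positive i))

  -- The squared form of s (2 + i) > 2 B √(B^(i + 1)), which stays within the naturals. The
  -- right-hand side bounds |G (suc i) + b G i|, because g (suc i) ≤ B g i and (g i)² ≤ B^(i + 1).
  FastGrowth : ℕ → Set
  FastGrowth i = 4 ℕ.* (B ℕ.* B) ℕ.* B ℕ.^ suc i ℕ.< S (suc i) ℕ.* S (suc i)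

  module _ (n : ℕ) (c : ℕ → ℤ) (c0 : c 0 ≡ 0ℤ) (interior : ∀ i → i ℕ.< n → 1ℤ ≤ facet c i)
    (minimal : ∀ f → f 0 ≡ 0ℤ → (∀ i → i ℕ.< n → 1ℤ ≤ facet f i) → ∀ i → i ℕ.< n → facet c i ≤ facet f i)
    (0<B : 0 ℕ.< B) where

    private
      -- By minimality this is gcd (sᵢ₊₁, sᵢ₊₂).
      G : ℕ → ℤ
      G i = facet c (suc i)

      g : ℕ → ℕ
      g i = ∣ G i ∣

    G>0 : ∀ i → suc i ℕ.< n → 0ℤ < G i
    G>0 i lt = ℤP.<-≤-trans (ℤ.+<+ ℕP.≤-refl) (interior (suc i) lt)

    +g : ∀ i → suc i ℕ.< n → + g i ≡ G i
    +g i lt = ℤP.0≤i⇒+∣i∣≡i (ℤP.<⇒≤ (G>0 i lt))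

    g>0 : ∀ i → suc i ℕ.< n → 0 ℕ.< g i
    g>0 i lt = ℤP.drop‿+<+ (subst (0ℤ <_) (sym (+g i lt)) (G>0 i lt))

    private
      multiple : ∀ i → suc i ℕ.< n → ∀ f → f 0 ≡ 0ℤ → ∃[ q ] facet f (suc i) ≡ q * G i
      multiple i lt = FacetDivisibility.facet-multiple σ σ>0 n c c0 minimal (suc i) lt (G>0 i lt)

    -- The test point is (0, ..., 0, 1, 1, ...) with its first 1 at index i + 2.
    divides-left : ∀ i → suc i ℕ.< n → ∃[ q ] s (suc i) ≡ q * G i
    divides-left i lt = proj₁ m , trans (sym value) (proj₂ m)
      where
      m = multiple i lt (step (suc i)) refl
      simplify : ∀ x y → 1ℤ * x - 0ℤ * y ≡ x
      simplify = solve-∀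
      value : facet (step (suc i)) (suc i) ≡ s (suc i)
      value = trans (cong₂ (λ x y → x * σ (suc i) - y * σ (suc (suc i))) (step-suc (suc i)) (step-refl (suc i)))
        (simplify (σ (suc i)) (σ (suc (suc i))))

    -- Starting the ones one place earlier realizes the difference of the two consecutive terms as a
    -- facet value, and the left term is already known to be a multiple.
    divides-right : ∀ i → suc i ℕ.< n → ∃[ q ] s (2 ℕ.+ i) ≡ q * G i
    divides-right i lt = p - q , trans (solve-for (s (suc i)) (s (2 ℕ.+ i)) (trans (sym value) (proj₂ m)) (proj₂ (divides-left i lt)))
        (sym (distribute p q (G i)))
      where
      m = multiple i lt (step i) (step-zero i)
      p = proj₁ (divides-left i lt)
      q = proj₁ m
      value : facet (step i) (suc i) ≡ 1ℤ * s (suc i) - 1ℤ * s (2 ℕ.+ i)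
      value = cong₂ (λ x y → x * s (suc i) - y * s (2 ℕ.+ i)) (step-< i (2 ℕ.+ i) (ℕP.m<n⇒m<1+n ℕP.≤-refl)) (step-suc i)
      distribute : ∀ p q x → (p - q) * x ≡ p * x - q * x
      distribute = solve-∀
      solve-for : ∀ x y {u v} → 1ℤ * x - 1ℤ * y ≡ u → x ≡ v → y ≡ v - u
      solve-for x y refl refl = lemma x y
        where
        lemma : ∀ x y → y ≡ x - (1ℤ * x - 1ℤ * y)
        lemma = solve-∀

    defect : ℕ → ℤ
    defect i = c (3 ℕ.+ i) - ℓ * c (2 ℕ.+ i) - b * c (suc i)

    -- Expanding s (3 + i) by its recurrence cancels the cross term containing s (suc i); what
    -- remains is s (2 + i) times the failure of c to satisfy the recurrence.
    recurrence : ∀ i → s (2 ℕ.+ i) * defect i ≡ G (suc i) + b * G i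
    recurrence i = identity ℓ b (s (2 ℕ.+ i)) (s (suc i)) (c (3 ℕ.+ i)) (c (2 ℕ.+ i)) (c (suc i))
      where
      identity : ∀ ℓ b y x w v u → y * (w - ℓ * v - b * u) ≡ (w * y - v * (ℓ * y + b * x)) + b * (v * x - u * y)
      identity = solve-∀

    -- As G (suc i) divides s (2 + i), `recurrence` makes it divide b G i, which is nonzero.
    g-step : ∀ i → 2 ℕ.+ i ℕ.< n → g (suc i) ℕ.≤ B ℕ.* g i
    g-step i lt with divides-left (suc i) lt
    ... | q , eq = factor≤ (∣ q * defect i - 1ℤ ∣) (trans (sym (ℤP.abs-* b (G i))) (trans (cong ∣_∣ product) (ℤP.abs-* (q * defect i - 1ℤ) (G (suc i)))))
      where
      product : b * G i ≡ (q * defect i - 1ℤ) * G (suc i)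
      product = solve-for (G (suc i)) (b * G i) (trans (cong (_* defect i) (sym eq)) (recurrence i))
        where
        solve-for : ∀ x y → q * x * defect i ≡ x + y → y ≡ (q * defect i - 1ℤ) * x
        solve-for x y e = trans (lemma₁ x y) (trans (cong (_- x) (sym e)) (lemma₂ q (defect i) x))
          where
          lemma₁ : ∀ x y → y ≡ x + y - x
          lemma₁ = solve-∀
          lemma₂ : ∀ q d x → q * x * d - x ≡ (q * d - 1ℤ) * x
          lemma₂ = solve-∀
      factor≤ : ∀ m → B ℕ.* g i ≡ m ℕ.* g (suc i) → g (suc i) ℕ.≤ B ℕ.* g i
      factor≤ zero    e = contradiction (ℕP.*-mono-≤ 0<B (g>0 i (ℕP.<-trans (ℕP.n<1+n _) lt))) (λ p → ℕP.<-irrefl refl (ℕP.<-≤-trans p (ℕP.≤-reflexive e)))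
      factor≤ (suc m) e = ℕP.≤-trans (ℕP.m≤m+n (g (suc i)) (m ℕ.* g (suc i))) (ℕP.≤-reflexive (sym e))

    -- Writing both sequence terms as multiples of G i pulls (G i)² out of the quadratic form of
    -- `determinant`, whose value (-b)^(i + 1) is nonzero.
    g²-bound : ∀ i → suc i ℕ.< n → g i ℕ.* g i ℕ.≤ B ℕ.^ suc i
    g²-bound i lt = factor≤ (∣ z ∣) (trans (sym (trans (∣^∣ (- b) (suc i)) (cong (ℕ._^ suc i) (ℤP.∣-i∣≡∣i∣ b))))
        (trans (cong ∣_∣ product) (trans (ℤP.abs-* z (G i * G i)) (cong (∣ z ∣ ℕ.*_) (ℤP.abs-* (G i) (G i))))))
      where
      x = proj₁ (divides-left i lt)
      y = proj₁ (divides-right i lt)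
      z = y * y - ℓ * (y * x) - b * (x * x)
      identity : ∀ ℓ b x y g → (y * g) * (y * g) - ℓ * ((y * g) * (x * g)) - b * ((x * g) * (x * g))
        ≡ (y * y - ℓ * (y * x) - b * (x * x)) * (g * g)
      identity = solve-∀
      product : (- b) ℤ.^ suc i ≡ z * (G i * G i)
      product = trans (sym (determinant (suc i))) (trans
        (cong₂ (λ u v → v * v - ℓ * (v * u) - b * (u * u)) (proj₂ (divides-left i lt)) (proj₂ (divides-right i lt)))
        (identity ℓ b x y (G i)))
      factor≤ : ∀ m → B ℕ.^ suc i ≡ m ℕ.* (g i ℕ.* g i) → g i ℕ.* g i ℕ.≤ B ℕ.^ suc i
      factor≤ zero    e = contradiction (^-pos B (suc i) 0<B) (λ p → ℕP.<-irrefl refl (ℕP.<-≤-trans p (ℕP.≤-reflexive e)))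
      factor≤ (suc m) e = ℕP.≤-trans (ℕP.m≤m+n (g i ℕ.* g i) (m ℕ.* (g i ℕ.* g i))) (ℕP.≤-reflexive (sym e))

    -- sᵢ₊₂ divides G (i+1) + b G i, which is too small to be a nonzero multiple.
    fastGrowth⇒ : ∀ i → 2 ℕ.+ i ℕ.< n → FastGrowth i → G (suc i) ≡ - b * G i
    fastGrowth⇒ i lt growth = conclude (defect i ℤ.≟ 0ℤ)
      where
      lt′ : suc i ℕ.< n
      lt′ = ℕP.<-trans (ℕP.n<1+n _) lt
      solve-for : ∀ x y → x + b * y ≡ 0ℤ → x ≡ - b * y
      solve-for x y e = trans (lemma b x y) (trans (cong (_+ - b * y) e) (ℤP.+-identityˡ _))
        where
        lemma : ∀ b x y → x ≡ x + b * y + - b * y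
        lemma = solve-∀
      m≤m*n : ∀ m k → k ≢ 0 → m ℕ.≤ m ℕ.* k
      m≤m*n m zero    k≢0 = contradiction refl k≢0
      m≤m*n m (suc k) _   = ℕP.m≤m*n m (suc k)
      small : defect i ≢ 0ℤ → S (suc i) ℕ.≤ 2 ℕ.* (B ℕ.* g i)
      small d≢0 = begin
        S (suc i)                          ≤⟨ m≤m*n (S (suc i)) (∣ defect i ∣) (λ e → d≢0 (ℤP.∣i∣≡0⇒i≡0 e)) ⟩
        S (suc i) ℕ.* ∣ defect i ∣         ≡⟨ sym (ℤP.abs-* (s (2 ℕ.+ i)) (defect i)) ⟩
        ∣ s (2 ℕ.+ i) * defect i ∣         ≡⟨ cong ∣_∣ (recurrence i) ⟩
        ∣ G (suc i) + b * G i ∣            ≤⟨ ℤP.∣i+j∣≤∣i∣+∣j∣ (G (suc i)) (b * G i) ⟩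
        g (suc i) ℕ.+ ∣ b * G i ∣          ≡⟨ cong (g (suc i) ℕ.+_) (ℤP.abs-* b (G i)) ⟩
        g (suc i) ℕ.+ B ℕ.* g i            ≤⟨ ℕP.+-monoˡ-≤ (B ℕ.* g i) (g-step i lt) ⟩
        B ℕ.* g i ℕ.+ B ℕ.* g i            ≡⟨ cong (B ℕ.* g i ℕ.+_) (sym (ℕP.+-identityʳ _)) ⟩
        2 ℕ.* (B ℕ.* g i)                  ∎
        where open ℕP.≤-Reasoning
      square : ∀ x y → 2 ℕ.* (x ℕ.* y) ℕ.* (2 ℕ.* (x ℕ.* y)) ≡ 4 ℕ.* (x ℕ.* x) ℕ.* (y ℕ.* y)
      square = ℕSolver.solve-∀
      conclude : Dec (defect i ≡ 0ℤ) → G (suc i) ≡ - b * G i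
      conclude (yes d≡0) = solve-for (G (suc i)) (G i) (trans (sym (recurrence i)) (trans (cong (s (2 ℕ.+ i) *_) d≡0) (ℤP.*-zeroʳ (s (2 ℕ.+ i)))))
      conclude (no d≢0)  = contradiction growth (ℕP.≤⇒≯ (begin
        S (suc i) ℕ.* S (suc i)                            ≤⟨ ℕP.*-mono-≤ (small d≢0) (small d≢0) ⟩
        2 ℕ.* (B ℕ.* g i) ℕ.* (2 ℕ.* (B ℕ.* g i))          ≡⟨ square B (g i) ⟩
        4 ℕ.* (B ℕ.* B) ℕ.* (g i ℕ.* g i)                  ≤⟨ ℕP.*-monoʳ-≤ (4 ℕ.* (B ℕ.* B)) (g²-bound i lt′) ⟩
        4 ℕ.* (B ℕ.* B) ℕ.* B ℕ.^ suc i                    ∎))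
        where open ℕP.≤-Reasoning

    -- A single index of fast growth suffices, since G (suc i) = - b G i already has the wrong sign
    -- there.
    positive-contradiction : 0ℤ < b → ∀ i → 2 ℕ.+ i ℕ.< n → ¬ FastGrowth i
    positive-contradiction 0<b i lt growth = ℤP.<-asym (G>0 (suc i) lt)
      (subst (_< 0ℤ) (sym (trans (fastGrowth⇒ i lt growth) (sym (ℤP.neg-distribˡ-* b (G i)))))
        (ℤP.neg-mono-< (*-pos 0<b (G>0 i (ℕP.<-trans (ℕP.n<1+n _) lt)))))

    module _ (I : ℕ) (growth : ∀ k → FastGrowth (I ℕ.+ k)) where

      geometric : ∀ k → suc (I ℕ.+ k) ℕ.< n → g (I ℕ.+ k) ≡ B ℕ.^ k ℕ.* g I
      geometric zero    lt = trans (cong g (ℕP.+-identityʳ I)) (sym (ℕP.+-identityʳ (g I)))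
      geometric (suc k) lt = trans (cong g (ℕP.+-suc I k)) (trans
        (cong ∣_∣ (fastGrowth⇒ (I ℕ.+ k) lt′ (growth k)))
        (trans (ℤP.abs-* (- b) (G (I ℕ.+ k))) (trans
          (cong₂ ℕ._*_ (ℤP.∣-i∣≡∣i∣ b) (geometric k (ℕP.<-trans (ℕP.n<1+n _) lt′)))
          (sym (ℕP.*-assoc B (B ℕ.^ k) (g I))))))
        where
        lt′ : 2 ℕ.+ (I ℕ.+ k) ℕ.< n
        lt′ = subst (λ m → suc m ℕ.< n) (ℕP.+-suc I k) lt

      -- At index I + k the growth gives g² ≥ B ^ (2k), against the bound B ^ (I + k + 1).
      geometric-contradiction : 1 ℕ.< B → ¬ (suc (I ℕ.+ (2 ℕ.+ I)) ℕ.< n)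
      geometric-contradiction 1<B lt = ℕP.<-irrefl refl (ℕP.<-≤-trans (ℕP.^-monoʳ-< B 1<B exponent<) (begin
        B ℕ.^ (k ℕ.+ k)                            ≡⟨ ℕP.^-distribˡ-+-* B k k ⟩
        B ℕ.^ k ℕ.* B ℕ.^ k                        ≤⟨ ℕP.*-mono-≤ grow grow ⟩
        g (I ℕ.+ k) ℕ.* g (I ℕ.+ k)                ≤⟨ g²-bound (I ℕ.+ k) lt ⟩
        B ℕ.^ suc (I ℕ.+ k)                        ∎))
        where
        open ℕP.≤-Reasoning
        -- The least k with I + k + 1 < 2 k.
        k = 2 ℕ.+ I
        exponent< : suc (I ℕ.+ k) ℕ.< k ℕ.+ k
        exponent< = ℕP.≤-refl
        grow : B ℕ.^ k ℕ.≤ g (I ℕ.+ k)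
        grow = ℕP.≤-trans (ℕP.m≤m*n (B ℕ.^ k) (g I) {{ℕ.>-nonZero (g>0 I (ℕP.≤-<-trans (ℕ.s≤s (ℕP.m≤m+n I k)) lt))}})
          (ℕP.≤-reflexive (sym (geometric k lt)))

  -- Growth of the sequence for b > 0 and for b < 0

  private
    square-S : ∀ i → + (S i ℕ.* S i) ≡ s (suc i) * s (suc i)
    square-S i = trans (ℤP.pos-* (S i) (S i)) (cong₂ _*_ (+S i) (+S i))

  -- Two steps of the recurrence multiply by at least b, and at even indices the summand ℓ s adds a
  -- further power of b each time. The resulting factor p + 1 is what overtakes the constant in
  -- `FastGrowth`.
  positive-growth : b ≡ + B → ∀ p → + (B ℕ.^ p) ≤ s (suc (double p)) × + (suc p ℕ.* B ℕ.^ p) ≤ s (2 ℕ.+ double p)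
  positive-growth b≡ zero    = ℤP.≤-refl , subst (1ℤ ≤_) (sym (simplify ℓ b)) (ℤP.i<j⇒suc[i]≤j 0<ℓ)
    where
    simplify : ∀ ℓ b → ℓ * 1ℤ + b * 0ℤ ≡ ℓ
    simplify = solve-∀
  positive-growth b≡ (suc p) = odd , even
    where
    ih = positive-growth b≡ p
    1≤ℓ : 1ℤ ≤ ℓ
    1≤ℓ = ℤP.i<j⇒suc[i]≤j 0<ℓ
    scale : ∀ m {x} → + m ≤ x → + (B ℕ.* m) ≤ b * x
    scale m {x} le = subst₂ _≤_ (sym (ℤP.pos-* B m)) (cong (_* x) (sym b≡)) (ℤP.*-monoˡ-≤-nonNeg (+ B) le)
    odd : + (B ℕ.^ suc p) ≤ s (3 ℕ.+ double p)
    odd = subst (_≤ s (3 ℕ.+ double p)) (ℤP.+-identityˡ _)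
      (ℤP.+-mono-≤ (*-nonNeg (ℤP.<⇒≤ 0<ℓ) (ℤP.<⇒≤ (positive (suc (double p))))) (scale (B ℕ.^ p) (proj₁ ih)))
    even : + (suc (suc p) ℕ.* B ℕ.^ suc p) ≤ s (4 ℕ.+ double p)
    even = subst (_≤ s (4 ℕ.+ double p)) (cong +_ (regroup p B (B ℕ.^ p)))
      (ℤP.+-mono-≤ (ℤP.≤-trans odd (ℤP.≤-trans (ℤP.≤-reflexive (sym (ℤP.*-identityˡ _)))
        (ℤP.*-monoʳ-≤-nonNeg (s (3 ℕ.+ double p)) {{ℤ.nonNegative (ℤP.<⇒≤ (positive (2 ℕ.+ double p)))}} 1≤ℓ)))
        (scale (suc p ℕ.* B ℕ.^ p) (proj₂ ih)))
      where
      regroup : ∀ p B X → B ℕ.* X ℕ.+ B ℕ.* (suc p ℕ.* X) ≡ suc (suc p) ℕ.* (B ℕ.* X)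
      regroup = ℕSolver.solve-∀

  -- With p = 2 B² the growth bound squares to (2 B² + 1)² B^(2p), and (2 B² + 1)² = 4 B⁴ + 4 B² + 1
  -- exceeds the required 4 B³.
  positive-fastGrowth : b ≡ + B → 0 ℕ.< B → FastGrowth (double (2 ℕ.* (B ℕ.* B)))
  positive-fastGrowth b≡ 0<B = ℕP.<-≤-trans below (ℕP.*-mono-≤ even even)
    where
    p = 2 ℕ.* (B ℕ.* B)
    X = B ℕ.^ p
    even : suc p ℕ.* X ℕ.≤ S (suc (double p))
    even = ℤP.drop‿+≤+ (subst (+ (suc p ℕ.* X) ≤_) (sym (+S (suc (double p)))) (proj₂ (positive-growth b≡ p)))
    base< : ∀ B → 0 ℕ.< B → ∀ Y → 0 ℕ.< Y → 4 ℕ.* (B ℕ.* B) ℕ.* (B ℕ.* Y) ℕ.< suc (2 ℕ.* (B ℕ.* B)) ℕ.* suc (2 ℕ.* (B ℕ.* B)) ℕ.* Y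
    base< (suc β) _ Y@(suc Y′) _ = subst (4 ℕ.* (suc β ℕ.* suc β) ℕ.* (suc β ℕ.* Y) ℕ.<_) (identity β Y)
      (ℕP.m<m+n _ (ℕ.s≤s ℕ.z≤n))
      where
      -- The gap (2 B² + 1)² - 4 B³ = 1 + 4 B³ (B - 1) + 4 B², with B = suc β to keep every
      -- coefficient natural.
      identity : ∀ β Y → 4 ℕ.* (suc β ℕ.* suc β) ℕ.* (suc β ℕ.* Y) ℕ.+ (Y ℕ.+ (4 ℕ.* (suc β ℕ.* suc β) ℕ.* (suc β ℕ.* β) ℕ.+ 4 ℕ.* (suc β ℕ.* suc β)) ℕ.* Y)
        ≡ suc (2 ℕ.* (suc β ℕ.* suc β)) ℕ.* suc (2 ℕ.* (suc β ℕ.* suc β)) ℕ.* Y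
      identity = ℕSolver.solve-∀
    regroup : ∀ m x → m ℕ.* m ℕ.* (x ℕ.* x) ≡ m ℕ.* x ℕ.* (m ℕ.* x)
    regroup = ℕSolver.solve-∀
    below : 4 ℕ.* (B ℕ.* B) ℕ.* B ℕ.^ suc (double p) ℕ.< suc p ℕ.* X ℕ.* (suc p ℕ.* X)
    below = subst₂ ℕ._<_ (cong (λ y → 4 ℕ.* (B ℕ.* B) ℕ.* (B ℕ.* y)) (sym (^-double B p))) (regroup (suc p) X)
      (base< B 0<B (X ℕ.* X) (ℕP.*-mono-≤ (^-pos B p 0<B) (^-pos B p 0<B)))

  -- Squaring the ratio bound and inserting ℓ² ≥ 4 B, the discriminant condition, gains the factor
  -- (k + 2)² B / (k + 1)² at each step. Squares avoid √B; a double root gives equality.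
  negative-growth : b ≡ - + B → ∀ k → + suc k * + suc k * (+ B) ℤ.^ k ≤ s (suc k) * s (suc k)
  negative-growth b≡ zero    = ℤP.≤-refl
  negative-growth b≡ (suc k) = ℤP.*-cancelˡ-≤-pos _ _ (+ 4 * (K * K)) {{ℤ.positive (*-pos (0<+suc 3) (*-pos (0<+suc k) (0<+suc k)))}}
    (ℤP.≤-trans first second)
    where
    K = + suc k
    K′ = + suc (suc k)
    x = s (suc k)
    y = s (2 ℕ.+ k)
    P = (+ B) ℤ.^ k
    4B≤ℓ² : + 4 * + B ≤ ℓ * ℓ
    4B≤ℓ² = difference⇒≤ _ discriminant (trans (cong (λ b → ℓ * ℓ + + 4 * b) b≡) (identity ℓ (+ B)))
      where
      identity : ∀ ℓ B → ℓ * ℓ + + 4 * - B ≡ ℓ * ℓ - + 4 * B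
      identity = solve-∀
    first : + 4 * (K * K) * (K′ * K′ * (+ B * P)) ≤ K′ * (ℓ * x) * (K′ * (ℓ * x))
    first = subst₂ _≤_ (regroup₁ K K′ (+ B) P) (regroup₂ K′ ℓ x)
      (ℤP.*-monoˡ-≤-nonNeg (K′ * K′) {{ℤ.nonNegative (*-nonNeg (ℤ.+≤+ (ℕ.z≤n {suc (suc k)})) (ℤ.+≤+ (ℕ.z≤n {suc (suc k)})))}}
        (*-mono-≤-nonNeg (*-nonNeg (ℤ.+≤+ (ℕ.z≤n {4})) (ℤ.+≤+ (ℕ.z≤n {B}))) (*-nonNeg (ℤP.<⇒≤ (positive k)) (ℤP.<⇒≤ (positive k)))
          4B≤ℓ² (negative-growth b≡ k)))
      where
      regroup₁ : ∀ K K′ B P → K′ * K′ * (+ 4 * B * (K * K * P)) ≡ + 4 * (K * K) * (K′ * K′ * (B * P))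
      regroup₁ = solve-∀
      regroup₂ : ∀ K′ ℓ x → K′ * K′ * (ℓ * ℓ * (x * x)) ≡ K′ * (ℓ * x) * (K′ * (ℓ * x))
      regroup₂ = solve-∀
    ratio : K′ * (ℓ * x) ≤ + 2 * (K * y)
    ratio = proj₂ (positive×ratio k)
    lower : 0ℤ ≤ K′ * (ℓ * x)
    lower = *-nonNeg (ℤ.+≤+ (ℕ.z≤n {suc (suc k)})) (*-nonNeg (ℤP.<⇒≤ 0<ℓ) (ℤP.<⇒≤ (positive k)))
    second : K′ * (ℓ * x) * (K′ * (ℓ * x)) ≤ + 4 * (K * K) * (y * y)
    second = subst (K′ * (ℓ * x) * (K′ * (ℓ * x)) ≤_) (regroup K y)
      (*-mono-≤-nonNeg lower (ℤP.≤-trans lower ratio) ratio ratio)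
      where
      regroup : ∀ K y → + 2 * (K * y) * (+ 2 * (K * y)) ≡ + 4 * (K * K) * (y * y)
      regroup = solve-∀

  -- The factor (i + 2)² of the growth bound exceeds (2 B)² as soon as i ≥ 2 B.
  negative-fastGrowth : b ≡ - + B → 0 ℕ.< B → ∀ k → FastGrowth (2 ℕ.* B ℕ.+ k)
  negative-fastGrowth b≡ 0<B k = ℕP.<-≤-trans
    (subst (ℕ._< m ℕ.* m ℕ.* X) (cong (ℕ._* X) (square B)) (ℕP.*-monoˡ-< X {{ℕ.>-nonZero (^-pos B (suc i) 0<B)}} (ℕP.*-mono-< 2B<m 2B<m)))
    (ℤP.drop‿+≤+ (subst₂ _≤_ cast (sym (square-S (suc i))) (negative-growth b≡ (suc i))))
    where
    i = 2 ℕ.* B ℕ.+ k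
    m = 2 ℕ.+ i
    X = B ℕ.^ suc i
    2B<m : 2 ℕ.* B ℕ.< m
    2B<m = ℕ.s≤s (ℕP.m≤n⇒m≤1+n (ℕP.m≤m+n (2 ℕ.* B) k))
    square : ∀ x → 2 ℕ.* x ℕ.* (2 ℕ.* x) ≡ 4 ℕ.* (x ℕ.* x)
    square = ℕSolver.solve-∀
    cast : + m * + m * (+ B) ℤ.^ suc i ≡ + (m ℕ.* m ℕ.* X)
    cast = sym (trans (ℤP.pos-* (m ℕ.* m) X) (cong₂ _*_ (ℤP.pos-* m m) (pos-^ B (suc i))))

  minimal-point : ∀ n → SelfReciprocal (lhGF s n) → ∃[ c ] c 0 ≡ 0ℤ × (∀ i → i ℕ.< n → 1ℤ ≤ facet c i) ×
    (∀ f → f 0 ≡ 0ℤ → (∀ i → i ℕ.< n → 1ℤ ≤ facet f i) → ∀ i → i ℕ.< n → facet c i ≤ facet f i)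
  minimal-point n sr = Reciprocity.selfReciprocal⇒minimalInteriorPoint σ σ>0 n (selfReciprocal-resp-≈S (lhGF≈closed n) sr)

  -- At index i the argument compares facets i + 1 and i + 2, so n must exceed i + 2, with i the
  -- index supplied by `positive-fastGrowth`.
  positive-notSelfReciprocal : b ≡ + B → 0 ℕ.< B → ∀ n → n ≥ 3 ℕ.+ double (2 ℕ.* (B ℕ.* B)) → ¬ SelfReciprocal (lhGF s n)
  positive-notSelfReciprocal b≡ 0<B n n≥ sr =
    let c , c0 , interior , minimal = minimal-point n sr
    in positive-contradiction n c c0 interior minimal 0<B (subst (0ℤ <_) (sym b≡) (ℤ.+<+ 0<B)) (double (2 ℕ.* (B ℕ.* B))) n≥ (positive-fastGrowth b≡ 0<B)

  -- Fast growth sets in at I = 2 B, and the contradiction is reached at facet 2 I + 3, which must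
  -- lie below n.
  negative-notSelfReciprocal : b ≡ - + B → 1 ℕ.< B → ∀ n → n ≥ 2 ℕ.+ (2 ℕ.* B ℕ.+ (2 ℕ.+ 2 ℕ.* B)) → ¬ SelfReciprocal (lhGF s n)
  negative-notSelfReciprocal b≡ 1<B n n≥ sr =
    let c , c0 , interior , minimal = minimal-point n sr
        0<B = ℕP.<-trans (ℕ.s≤s ℕ.z≤n) 1<B
    in geometric-contradiction n c c0 interior minimal 0<B (2 ℕ.* B) (negative-fastGrowth b≡ 0<B) 1<B n≥

eventually-notSelfReciprocal : ∀ ℓ b → 0ℤ < ℓ → b ≢ 0ℤ → 0ℤ ≤ ℓ * ℓ + + 4 * b → b ≢ -1ℤ →
  ∃[ n₀ ] (∀ n → n ≥ n₀ → ¬ SelfReciprocal (lhGF (seq ℓ b) n))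
eventually-notSelfReciprocal ℓ (+ zero)      0<ℓ b≢0 disc b≢-1 = contradiction refl b≢0
eventually-notSelfReciprocal ℓ (+ suc β)     0<ℓ b≢0 disc b≢-1 =
  _ , NotSelfReciprocal.positive-notSelfReciprocal ℓ (+ suc β) 0<ℓ disc refl (ℕ.s≤s ℕ.z≤n)
eventually-notSelfReciprocal ℓ -[1+ zero ]   0<ℓ b≢0 disc b≢-1 = contradiction refl b≢-1
eventually-notSelfReciprocal ℓ -[1+ suc β ]  0<ℓ b≢0 disc b≢-1 =
  _ , NotSelfReciprocal.negative-notSelfReciprocal ℓ -[1+ suc β ] 0<ℓ disc refl (ℕ.s≤s (ℕ.s≤s ℕ.z≤n))

theorem1p4 : (ℓ b : ℤ) → 0ℤ < ℓ → b ≢ 0ℤ → 0ℤ ≤ ℓ * ℓ + + 4 * b →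
    ((∀ (n : ℕ) → SelfReciprocal (lhGF (seq ℓ b) n)) ⇔ (b ≡ -1ℤ))
    × (b ≢ -1ℤ → ∃[ n₀ ] (∀ (n : ℕ) → n ≥ n₀ →
    ¬ SelfReciprocal (lhGF (seq ℓ b) n) × ¬ IsProductForm n (lhGF (seq ℓ b) n)))
theorem1p4 ℓ b 0<ℓ b≢0 disc = mk⇔ only-if (λ b≡-1 → Sequence.b≡-1⇒selfReciprocal ℓ b 0<ℓ disc b≡-1) , eventually
  where
  eventually : b ≢ -1ℤ → ∃[ n₀ ] (∀ (n : ℕ) → n ≥ n₀ →
    ¬ SelfReciprocal (lhGF (seq ℓ b) n) × ¬ IsProductForm n (lhGF (seq ℓ b) n))
  eventually b≢-1 =
    let n₀ , fails = eventually-notSelfReciprocal ℓ b 0<ℓ b≢0 disc b≢-1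
    in n₀ , λ n n≥n₀ → fails n n≥n₀ , λ product → fails n n≥n₀ (productForm⇒selfReciprocal n _ product)
  only-if : (∀ (n : ℕ) → SelfReciprocal (lhGF (seq ℓ b) n)) → b ≡ -1ℤ
  only-if sr with b ℤ.≟ -1ℤ
  ... | yes b≡-1 = b≡-1
  ... | no b≢-1  = let n₀ , fails = eventually b≢-1 in contradiction (sr n₀) (proj₁ (fails n₀ ℕP.≤-refl))
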